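{- The isomorphism relation $\cong_{\mathcal{UF}^2_1}$ on c.e. presentations of $1$-generated algebras with two unary function symbols is a $\Sigma^0_3$-complete equivalence relation: it is $\Sigma^0_3$, and every $\Sigma^0_3$ equivalence relation on $\mathbb N$ is computably reducible to it.
   Context: $W_e$ denotes the $e$-th c.e. set. $\mathcal{UF}^2$ is the variety of all algebras in the signature consisting of two unary function symbols $f,g$, with no equational laws. Fix a computable bijective coding of pairs of terms over the single generator $x_0$ by natural numbers. $\mathcal{UF}^2_1[e]$ is the term algebra over $\{x_0\}$ modulo the smallest congruence containing all pairs coded in $W_e$, and $e\cong_{\mathcal{UF}^2_1}i$ iff $\mathcal{UF}^2_1[e]\cong\mathcal{UF}^2_1[i]$. For equivalence relations $E,F$ on $\mathbb N$, $E\le_c F$ (computable reducibility) means there is a total computable $h$ with $x\,E\,y\iff h(x)\,F\,h(y)$. -}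

module Defs where

open import Level using (0ℓ)
open import Data.Nat using (ℕ; zero; suc; _+_; _*_; _<_)
open import Data.Product using (Σ; ∃; ∃-syntax; _×_; _,_; proj₁; proj₂)
open import Relation.Binary.PropositionalEquality using (_≡_)
open import Relation.Binary using (Rel; IsEquivalence; Setoid)
open import Function.Bundles using (_⇔_)

tri : ℕ → ℕ
tri zero    = zero
tri (suc d) = tri d + suc d

pair : ℕ → ℕ → ℕ
pair a b = tri (a + b) + a

-- inverse of pair (enumeration of ℕ×ℕ along antidiagonals)
unpair : ℕ → ℕ × ℕ
unpair zero    = 0 , 0
unpair (suc n) = next (unpair n)
  where
  next : ℕ × ℕ → ℕ × ℕ
  next (a , zero)  = 0 , suc a
  next (a , suc b) = suc a , b

-- A standard model of partial recursive functions ℕ ⇀ ℕ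
-- (unary basis with Cantor pairing; complete for partial recursive functions)

data Prog : Set where
  Z S I Fst Snd : Prog
  Comp PairF Rec : Prog → Prog → Prog
  Mu : Prog → Prog

data Eval : Prog → ℕ → ℕ → Set where
  ev-Z   : ∀ x → Eval Z x 0
  ev-S   : ∀ x → Eval S x (suc x)
  ev-I   : ∀ x → Eval I x x
  ev-Fst : ∀ x → Eval Fst x (proj₁ (unpair x))
  ev-Snd : ∀ x → Eval Snd x (proj₂ (unpair x))
  ev-Comp : ∀ {p q x y z} → Eval q x y → Eval p y z → Eval (Comp p q) x z
  ev-PairF : ∀ {p q x a b} → Eval p x a → Eval q x b → Eval (PairF p q) x (pair a b)
  ev-Rec0 : ∀ {p q a y} → Eval p a y → Eval (Rec p q) (pair a 0) y
  ev-RecS : ∀ {p q a n y z} → Eval (Rec p q) (pair a n) y →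
            Eval q (pair a (pair n y)) z → Eval (Rec p q) (pair a (suc n)) z
  ev-Mu : ∀ {p a n} → Eval p (pair a n) 0 →
          (∀ m → m < n → Σ ℕ λ k → Eval p (pair a m) (suc k)) →
          Eval (Mu p) a n

-- bijective Gödel numbering of programs
encodeProg : Prog → ℕ
encodeProg Z = 0
encodeProg S = 1
encodeProg I = 2
encodeProg Fst = 3
encodeProg Snd = 4
encodeProg (Comp p q)  = 5 + 4 * pair (encodeProg p) (encodeProg q)
encodeProg (PairF p q) = 6 + 4 * pair (encodeProg p) (encodeProg q)
encodeProg (Rec p q)   = 7 + 4 * pair (encodeProg p) (encodeProg q)
encodeProg (Mu p)      = 8 + 4 * encodeProg p

Φ : ℕ → ℕ → ℕ → Set
Φ e x y = Σ Prog λ p → encodeProg p ≡ e × Eval p x y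

W : ℕ → ℕ → Set
W e x = ∃[ y ] Φ e x y

Computable : (ℕ → ℕ) → Set
Computable h = ∃[ c ] (∀ x → Φ c x (h x))

ComputablePred : (ℕ → Set) → Set
ComputablePred R = ∃[ r ] ((∀ n → ∃[ y ] Φ r n y) × (∀ n → R n ⇔ Φ r n 0))

Σ⁰₃ : Rel ℕ 0ℓ → Set₁
Σ⁰₃ E = Σ (ℕ → Set) λ R → ComputablePred R ×
          (∀ x y → E x y ⇔ (∃[ a ] ∀ b → ∃[ c ] R (pair x (pair y (pair a (pair b c))))))

_≤c_ : Rel ℕ 0ℓ → Rel ℕ 0ℓ → Set
E ≤c F = Σ (ℕ → ℕ) λ h → Computable h × (∀ x y → E x y ⇔ F (h x) (h y))

record UF2Alg : Set₁ where
  field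
    setoid : Setoid 0ℓ 0ℓ
  open Setoid setoid public
  field
    F G : Carrier → Carrier
    F-cong : ∀ {a b} → a ≈ b → F a ≈ F b
    G-cong : ∀ {a b} → a ≈ b → G a ≈ G b

record _≅_ (A B : UF2Alg) : Set where
  private
    module A = UF2Alg A
    module B = UF2Alg B
  field
    to   : A.Carrier → B.Carrier
    from : B.Carrier → A.Carrier
    to-cong   : ∀ {a a'} → a A.≈ a' → to a B.≈ to a'
    from-cong : ∀ {b b'} → b B.≈ b' → from b A.≈ from b'
    to-F : ∀ a → to (A.F a) B.≈ B.F (to a)
    to-G : ∀ a → to (A.G a) B.≈ B.G (to a)
    from-to : ∀ a → from (to a) A.≈ a
    to-from : ∀ b → to (from b) B.≈ b

data Term : Set where
  x₀ : Term
  f g : Term → Term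

-- bijective coding Term ≅ ℕ (words over {f,g} in bijective base 2)
encodeTerm : Term → ℕ
encodeTerm x₀    = 0
encodeTerm (f t) = 1 + 2 * encodeTerm t
encodeTerm (g t) = 2 + 2 * encodeTerm t

codePair : Term → Term → ℕ
codePair s t = pair (encodeTerm s) (encodeTerm t)

data Cong (e : ℕ) : Term → Term → Set where
  gen   : ∀ {s t} → W e (codePair s t) → Cong e s t
  refl  : ∀ {s} → Cong e s s
  sym   : ∀ {s t} → Cong e s t → Cong e t s
  trans : ∀ {s t u} → Cong e s t → Cong e t u → Cong e s u
  f-cong : ∀ {s t} → Cong e s t → Cong e (f s) (f t)
  g-cong : ∀ {s t} → Cong e s t → Cong e (g s) (g t)

UF²₁ : ℕ → UF2Alg
UF²₁ e = record
  { setoid = record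
      { Carrier = Term
      ; _≈_ = Cong e
      ; isEquivalence = record { refl = refl ; sym = sym ; trans = trans } }
  ; F = f ; G = g ; F-cong = f-cong ; G-cong = g-cong }

_≅UF²₁_ : Rel ℕ 0ℓ
e ≅UF²₁ i = UF²₁ e ≅ UF²₁ i

{-# OPTIONS --safe #-}
module Submission where

open import Defs
open import Level using (0ℓ)
open import Data.Nat
open import Data.Nat.Properties
open import Data.Nat.DivMod using (m≡m%n+[m/n]*n; m%n<n; m/n≤m; [m+kn]%n≡m%n; m<n⇒m%n≡m; +-distrib-/-∣ʳ; m*n/n≡m; m<n⇒m/n≡0)
open import Data.Nat.Divisibility using (n∣m*n)
open import Data.Fin using (Fin; zero; suc; toℕ; #_)
open import Data.Vec using (Vec; []; _∷_; lookup; _++_)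
open import Data.Vec.Properties using (∷-injective)
open import Data.Vec.Relation.Unary.All using (All; []; _∷_)
open import Data.Vec.Relation.Unary.All.Properties using (lookup⁺)
open import Data.List as List using (List; []; _∷_)
open import Data.Unit using (⊤; tt)
open import Data.Empty using (⊥-elim)
open import Data.Product using (Σ; ∃-syntax; _×_; _,_; proj₁; proj₂)
open import Data.Sum using (_⊎_; inj₁; inj₂)
open import Function.Bundles using (_⇔_; mk⇔; Equivalence)
open import Relation.Nullary using (¬_; yes; no)
open import Relation.Binary using (Rel; IsEquivalence)
open import Relation.Binary.Definitions using (tri<; tri≈; tri>)
open import Relation.Binary.PropositionalEquality as ≡ using (_≡_; _≢_; cong; cong₂; subst; subst₂)
open import Axiom.ExcludedMiddle using (ExcludedMiddle)

-- Upper bound. An isomorphism of 1-generated algebras is given by the images t, u of the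
-- generators: all relations of one algebra must hold in the other after x₀ ↦ t (resp. u), and
-- t[u] = x₀ = u[t]. Both membership in W e and provable equality are inductively generated by
-- finitely many effective rules, so they have decidable certificates and the condition is ∃∀∃.
--
-- Hardness. Let E be Σ⁰₃. For every n, the verified instances of E with codes below n generate
-- equivalence relations ~ₙₖ decreasing in k, such that x E y iff x ~ₙₖ y for all k, for almost
-- all (equivalently, for some) n. The algebra of x consists of the words of a group of
-- permutations of "positions" (n , c), together with queries: q w = w is imposed iff the query q,
-- transported along w, asks for a true relation name(c) ~ₙₖ j, where every column c carries a
-- fixed name, except for one column, which carries the name x at each level n. If x E y then one
-- group element renames x to y at the finitely many levels where x and y are not yet
-- equivalent, and levels above need no change; moving the generator by it is an isomorphism.
-- Conversely a homomorphism sends the generator to a term, which permutes only finitely many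
-- levels, so at a high level n the queries force y ~ₙₖ x for all k.

-- Cantor pairing and its inverse.

fst snd : ℕ → ℕ
fst n = proj₁ (unpair n)
snd n = proj₂ (unpair n)

pair-suc : ∀ a b → pair (suc a) b ≡ suc (pair a (suc b))
pair-suc a b rewrite +-suc a b = +-suc _ a

pair-zero-suc : ∀ b → pair 0 (suc b) ≡ suc (pair b 0)
pair-zero-suc b rewrite +-identityʳ b = ≡.trans (+-identityʳ _) (+-suc _ b)

-- Each antidiagonal is numbered consecutively: the proof walks back along it to first component
-- `0`, then to the end of the preceding antidiagonal, by induction on `a + b` and then on `a`.
unpair-pair : ∀ a b → unpair (pair a b) ≡ (a , b)
unpair-pair a b = go (a + b) a b ≡.refl
  where
  go : ∀ s a b → a + b ≡ s → unpair (pair a b) ≡ (a , b)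
  go s (suc a) b e rewrite pair-suc a b | go s a (suc b) (≡.trans (+-suc a b) e) = ≡.refl
  go zero zero .zero ≡.refl = ≡.refl
  go (suc s) zero .(suc s) ≡.refl rewrite pair-zero-suc s | go s s 0 (+-identityʳ s) = ≡.refl

fst-pair : ∀ a b → fst (pair a b) ≡ a
fst-pair a b = cong proj₁ (unpair-pair a b)

snd-pair : ∀ a b → snd (pair a b) ≡ b
snd-pair a b = cong proj₂ (unpair-pair a b)

pair-unpair : ∀ n → pair (fst n) (snd n) ≡ n
pair-unpair zero = ≡.refl
pair-unpair (suc n) with unpair n | pair-unpair n
... | a , zero  | ih = ≡.trans (pair-zero-suc a) (cong suc ih)
... | a , suc b | ih = ≡.trans (pair-suc a b) (cong suc ih)

pair-injectiveˡ : ∀ {a b c d} → pair a b ≡ pair c d → a ≡ c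
pair-injectiveˡ {a} {b} {c} {d} e = ≡.trans (≡.sym (fst-pair a b)) (≡.trans (cong fst e) (fst-pair c d))

pair-injectiveʳ : ∀ {a b c d} → pair a b ≡ pair c d → b ≡ d
pair-injectiveʳ {a} {b} {c} {d} e = ≡.trans (≡.sym (snd-pair a b)) (≡.trans (cong snd e) (snd-pair c d))

n≤tri : ∀ n → n ≤ tri n
n≤tri zero    = z≤n
n≤tri (suc n) = m≤n+m (suc n) (tri n)

a≤pair : ∀ a b → a ≤ pair a b
a≤pair a b = m≤n+m a (tri (a + b))

b≤pair : ∀ a b → b ≤ pair a b
b≤pair a b = ≤-trans (m≤n+m b a) (≤-trans (n≤tri (a + b)) (m≤m+n _ a))

fst≤ : ∀ n → fst n ≤ n
fst≤ n = subst (fst n ≤_) (pair-unpair n) (a≤pair (fst n) (snd n))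

snd≤ : ∀ n → snd n ≤ n
snd≤ n = subst (snd n ≤_) (pair-unpair n) (b≤pair (fst n) (snd n))

-- Bijectivity of the Gödel numbering of programs.

node : (ℕ → Prog) → ℕ → ℕ → Prog
node d 0 q = Comp (d (fst q)) (d (snd q))
node d 1 q = PairF (d (fst q)) (d (snd q))
node d 2 q = Rec (d (fst q)) (d (snd q))
-- Only residue `3` is meant here, since the selector is a remainder modulo `4`.
node d _ q = Mu (d q)

-- The first argument is fuel; any value above the code suffices.
decodeProg : ℕ → ℕ → Prog
decodeProg zero    _ = Z
decodeProg (suc k) 0 = Z
decodeProg (suc k) 1 = S
decodeProg (suc k) 2 = I
decodeProg (suc k) 3 = Fst
decodeProg (suc k) 4 = Snd
decodeProg (suc k) (suc (suc (suc (suc (suc m))))) = node (decodeProg k) (m % 4) (m / 4)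

node-% : ∀ r q → r < 4 → (r + 4 * q) % 4 ≡ r
node-% r q r<4 = ≡.trans (cong (λ m → (r + m) % 4) (*-comm 4 q))
                         (≡.trans ([m+kn]%n≡m%n r q 4) (m<n⇒m%n≡m r<4))

node-/ : ∀ r q → r < 4 → (r + 4 * q) / 4 ≡ q
node-/ r q r<4 = ≡.trans (cong (λ m → (r + m) / 4) (*-comm 4 q))
  (≡.trans (+-distrib-/-∣ʳ r (n∣m*n q)) (cong₂ _+_ (m<n⇒m/n≡0 r<4) (m*n/n≡m q 4)))

child< : ∀ {n k} r q → n ≤ q → 5 + (r + 4 * q) < suc k → n < k
child< r q n≤q (s≤s h) = ≤-trans (s≤s (≤-trans n≤q (≤-trans (m≤n*m q 4) (m≤n+m _ (4 + r))))) h

decode-encodeProg : ∀ k p → encodeProg p < k → decodeProg k (encodeProg p) ≡ p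
decode-encodeProg (suc k) Z   _ = ≡.refl
decode-encodeProg (suc k) S   _ = ≡.refl
decode-encodeProg (suc k) I   _ = ≡.refl
decode-encodeProg (suc k) Fst _ = ≡.refl
decode-encodeProg (suc k) Snd _ = ≡.refl
decode-encodeProg (suc k) (Comp p q) h
  rewrite node-% 0 (pair (encodeProg p) (encodeProg q)) (s≤s z≤n)
        | node-/ 0 (pair (encodeProg p) (encodeProg q)) (s≤s z≤n)
        | unpair-pair (encodeProg p) (encodeProg q)
  = cong₂ Comp (decode-encodeProg k p (child< 0 _ (a≤pair _ (encodeProg q)) h))
               (decode-encodeProg k q (child< 0 _ (b≤pair (encodeProg p) _) h))
decode-encodeProg (suc k) (PairF p q) h
  rewrite node-% 1 (pair (encodeProg p) (encodeProg q)) (s≤s (s≤s z≤n))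
        | node-/ 1 (pair (encodeProg p) (encodeProg q)) (s≤s (s≤s z≤n))
        | unpair-pair (encodeProg p) (encodeProg q)
  = cong₂ PairF (decode-encodeProg k p (child< 1 _ (a≤pair _ (encodeProg q)) h))
                (decode-encodeProg k q (child< 1 _ (b≤pair (encodeProg p) _) h))
decode-encodeProg (suc k) (Rec p q) h
  rewrite node-% 2 (pair (encodeProg p) (encodeProg q)) (s≤s (s≤s (s≤s z≤n)))
        | node-/ 2 (pair (encodeProg p) (encodeProg q)) (s≤s (s≤s (s≤s z≤n)))
        | unpair-pair (encodeProg p) (encodeProg q)
  = cong₂ Rec (decode-encodeProg k p (child< 2 _ (a≤pair _ (encodeProg q)) h))
              (decode-encodeProg k q (child< 2 _ (b≤pair (encodeProg p) _) h))
decode-encodeProg (suc k) (Mu p) h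
  rewrite node-% 3 (encodeProg p) ≤-refl | node-/ 3 (encodeProg p) ≤-refl
  = cong Mu (decode-encodeProg k p (child< 3 _ ≤-refl h))

-- `Φ` gives access to a program only through its code; this turns equations of codes back into
-- equations of programs.
encodeProg-injective : ∀ p q → encodeProg p ≡ encodeProg q → p ≡ q
encodeProg-injective p q e = ≡.trans (≡.sym (decode-encodeProg k p ≤-refl))
  (≡.trans (cong (decodeProg k) e) (decode-encodeProg k q (s≤s (≤-reflexive (≡.sym e)))))
  where k = suc (encodeProg p)

encode-node : ∀ (d : ℕ → Prog) r q → r < 4 → (∀ m → m ≤ q → encodeProg (d m) ≡ m) →
              encodeProg (node d r q) ≡ 5 + (r + 4 * q)
encode-node d r q r<4 h = go r r<4
  where
  halves : pair (encodeProg (d (fst q))) (encodeProg (d (snd q))) ≡ q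
  halves = ≡.trans (cong₂ pair (h _ (fst≤ q)) (h _ (snd≤ q))) (pair-unpair q)
  go : ∀ r → r < 4 → encodeProg (node d r q) ≡ 5 + (r + 4 * q)
  go 0 _ = cong (λ m → 5 + 4 * m) halves
  go 1 _ = cong (λ m → 6 + 4 * m) halves
  go 2 _ = cong (λ m → 7 + 4 * m) halves
  go 3 _ = cong (λ m → 8 + 4 * m) (h q ≤-refl)
  go (suc (suc (suc (suc _)))) (s≤s (s≤s (s≤s (s≤s ()))))

encode-decodeProg : ∀ k n → n < k → encodeProg (decodeProg k n) ≡ n
encode-decodeProg (suc k) 0 _ = ≡.refl
encode-decodeProg (suc k) 1 _ = ≡.refl
encode-decodeProg (suc k) 2 _ = ≡.refl
encode-decodeProg (suc k) 3 _ = ≡.refl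
encode-decodeProg (suc k) 4 _ = ≡.refl
encode-decodeProg (suc k) (suc (suc (suc (suc (suc m))))) (s≤s h) =
  ≡.trans (encode-node (decodeProg k) (m % 4) (m / 4) (m%n<n m 4)
             (λ j j≤ → encode-decodeProg k j (≤-trans (s≤s (≤-trans j≤ (≤-trans (m/n≤m m 4) (m≤n+m m 4)))) h)))
          (cong (5 +_) (≡.trans (cong (m % 4 +_) (*-comm 4 (m / 4))) (≡.sym (m≡m%n+[m/n]*n m 4))))

-- Enumerated facts and indices are bare numbers, and this lets any of them be read as a program.
encodeProg-surjective : ∀ n → ∃[ p ] encodeProg p ≡ n
encodeProg-surjective n = decodeProg (suc n) n , encode-decodeProg (suc n) n ≤-refl

-- Inversion and determinism of evaluation.

Rec-inv : ∀ {p q v y} → Eval (Rec p q) v y →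
  (∃[ a ] v ≡ pair a 0 × Eval p a y) ⊎
  (∃[ a ] ∃[ n ] ∃[ w ] v ≡ pair a (suc n) × Eval (Rec p q) (pair a n) w × Eval q (pair a (pair n w)) y)
Rec-inv (ev-Rec0 {a = a} d) = inj₁ (a , ≡.refl , d)
Rec-inv (ev-RecS {a = a} {n} {y} d e) = inj₂ (a , n , y , ≡.refl , d , e)

Mu-inv : ∀ {p v n} → Eval (Mu p) v n → Eval p (pair v n) 0 × (∀ m → m < n → ∃[ k ] Eval p (pair v m) (suc k))
Mu-inv (ev-Mu d h) = d , h

Eval-deterministic : ∀ {p x y z} → Eval p x y → Eval p x z → y ≡ z
Eval-deterministic (ev-Z _) (ev-Z _) = ≡.refl
Eval-deterministic (ev-S _) (ev-S _) = ≡.refl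
Eval-deterministic (ev-I _) (ev-I _) = ≡.refl
Eval-deterministic (ev-Fst _) (ev-Fst _) = ≡.refl
Eval-deterministic (ev-Snd _) (ev-Snd _) = ≡.refl
Eval-deterministic (ev-Comp d e) (ev-Comp d′ e′) with Eval-deterministic d d′
... | ≡.refl = Eval-deterministic e e′
Eval-deterministic (ev-PairF d e) (ev-PairF d′ e′) =
  cong₂ pair (Eval-deterministic d d′) (Eval-deterministic e e′)
-- `pair` is not a constructor, so the second derivation cannot be matched directly; `Rec-inv`
-- yields an equation of inputs, which injectivity of `pair` resolves.
Eval-deterministic {z = z} (ev-Rec0 {p} {q} {a} {y} d) e with Rec-inv e
... | inj₁ (a′ , eq , d′) = Eval-deterministic d (subst (λ a → Eval p a z) (≡.sym (pair-injectiveˡ {a} {0} {a′} {0} eq)) d′)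
... | inj₂ (a′ , n , _ , eq , _) with pair-injectiveʳ {a} {0} {a′} {suc n} eq
...   | ()
Eval-deterministic {z = z} (ev-RecS {p} {q} {a} {n} d₁ d₂) e with Rec-inv e
... | inj₁ (a′ , eq , _) with pair-injectiveʳ {a} {suc n} {a′} {0} eq
...   | ()
Eval-deterministic {z = z} (ev-RecS {p} {q} {a} {n} d₁ d₂) e
    | inj₂ (a′ , n′ , _ , eq , e₁ , e₂)
    with pair-injectiveˡ {a} {suc n} {a′} {suc n′} eq | pair-injectiveʳ {a} {suc n} {a′} {suc n′} eq
...   | ≡.refl | ≡.refl with Eval-deterministic d₁ e₁
...     | ≡.refl = Eval-deterministic d₂ e₂
Eval-deterministic {z = n′} (ev-Mu {p} {a} {n} d h) e with Mu-inv e | <-cmp n n′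
... | d′ , h′ | tri≈ _ n≡n′ _ = n≡n′
-- If two searches stopped at different places, the smaller place would evaluate both to `0` and to
-- a successor.
... | d′ , h′ | tri< n<n′ _ _ with Eval-deterministic d (proj₂ (h′ n n<n′))
...   | ()
Eval-deterministic {z = n′} (ev-Mu {p} {a} {n} d h) e | d′ , h′ | tri> _ _ n′<n
    with Eval-deterministic (proj₂ (h n′ n′<n)) d′
...   | ()

-- A small language of primitive recursive expressions

env : ∀ {n} → Vec ℕ n → ℕ
env []      = 0
env (x ∷ ρ) = pair x (env ρ)

Realised : ∀ {n} → (Vec ℕ n → ℕ) → Set
Realised F = Σ Prog λ p → ∀ ρ → Eval p (env ρ) (F ρ)

natrec : ℕ → (ℕ → ℕ → ℕ) → ℕ → ℕ
natrec b s zero    = b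
natrec b s (suc n) = s n (natrec b s n)

ifz : ℕ → ℕ → ℕ → ℕ
ifz zero    a b = a
ifz (suc _) a b = b

data Exp (n : ℕ) : Set where
  var       : Fin n → Exp n
  lit       : ℕ → Exp n
  sucE      : Exp n → Exp n
  pairE     : Exp n → Exp n → Exp n
  fstE sndE : Exp n → Exp n
  ifzE      : Exp n → Exp n → Exp n → Exp n
  recE      : Exp n → Exp (2 + n) → Exp n → Exp n
  -- Carrying a function together with its realiser makes derived operations denote the function
  -- itself, whatever program computes it.
  call      : ∀ {k} (F : Vec ℕ k → ℕ) → Realised F → Vec (Exp n) k → Exp n

⟦_⟧  : ∀ {n} → Exp n → Vec ℕ n → ℕ
⟦_⟧* : ∀ {n k} → Vec (Exp n) k → Vec ℕ n → Vec ℕ k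

⟦ var i ⟧ ρ       = lookup ρ i
⟦ lit c ⟧ ρ       = c
⟦ sucE e ⟧ ρ      = suc (⟦ e ⟧ ρ)
⟦ pairE d e ⟧ ρ   = pair (⟦ d ⟧ ρ) (⟦ e ⟧ ρ)
⟦ fstE e ⟧ ρ      = fst (⟦ e ⟧ ρ)
⟦ sndE e ⟧ ρ      = snd (⟦ e ⟧ ρ)
⟦ ifzE c d e ⟧ ρ  = ifz (⟦ c ⟧ ρ) (⟦ d ⟧ ρ) (⟦ e ⟧ ρ)
⟦ recE b s e ⟧ ρ  = natrec (⟦ b ⟧ ρ) (λ i r → ⟦ s ⟧ (i ∷ r ∷ ρ)) (⟦ e ⟧ ρ)
⟦ call F _ es ⟧ ρ = F (⟦ es ⟧* ρ)

⟦ [] ⟧* ρ     = []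
⟦ e ∷ es ⟧* ρ = ⟦ e ⟧ ρ ∷ ⟦ es ⟧* ρ

constP : ℕ → Prog
constP zero    = Z
constP (suc c) = Comp S (constP c)

ev-const : ∀ c x → Eval (constP c) x c
ev-const zero    x = ev-Z x
ev-const (suc c) x = ev-Comp (ev-const c x) (ev-S c)

ev-fst-pair : ∀ a b → Eval Fst (pair a b) a
ev-fst-pair a b = subst (Eval Fst (pair a b)) (fst-pair a b) (ev-Fst (pair a b))

ev-snd-pair : ∀ a b → Eval Snd (pair a b) b
ev-snd-pair a b = subst (Eval Snd (pair a b)) (snd-pair a b) (ev-Snd (pair a b))

realise-lookup : ∀ {n} (i : Fin n) → Realised (λ ρ → lookup ρ i)
realise-lookup zero = Fst , λ { (x ∷ ρ) → ev-fst-pair x (env ρ) }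
realise-lookup (suc i) with realise-lookup i
... | p , h = Comp p Snd , λ { (x ∷ ρ) → ev-Comp (ev-snd-pair x (env ρ)) (h ρ) }

-- `Rec` hands its step program the parameters first, whereas the environment `i ∷ r ∷ ρ` has them
-- last.
rotate : Prog
rotate = PairF (Comp Fst Snd) (PairF (Comp Snd Snd) Fst)

ev-rotate : ∀ a i r → Eval rotate (pair a (pair i r)) (pair i (pair r a))
ev-rotate a i r =
  ev-PairF {a = i} (ev-Comp (ev-snd-pair a _) (ev-fst-pair i r))
    (ev-PairF {a = r} (ev-Comp (ev-snd-pair a _) (ev-snd-pair i r)) (ev-fst-pair a (pair i r)))

ev-natrec : ∀ {p q} a b (s : ℕ → ℕ → ℕ) → Eval p a b → (∀ i r → Eval q (pair i (pair r a)) (s i r)) →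
            ∀ n → Eval (Rec p (Comp q rotate)) (pair a n) (natrec b s n)
ev-natrec a b s hp hq zero    = ev-Rec0 hp
ev-natrec a b s hp hq (suc n) =
  ev-RecS {a = a} {n = n} (ev-natrec a b s hp hq n) (ev-Comp (ev-rotate a n (natrec b s n)) (hq n (natrec b s n)))

-- Branching is primitive recursion whose step discards the counter and the previous value.
ev-ifz : ∀ {p q} a b c → Eval p a b → Eval q a c → ∀ n → Eval (Rec p (Comp q Fst)) (pair a n) (ifz n b c)
ev-ifz a b c hp hq zero          = ev-Rec0 hp
ev-ifz a b c hp hq (suc zero)    = ev-RecS {a = a} {n = 0} (ev-Rec0 hp) (ev-Comp (ev-fst-pair a (pair 0 b)) hq)
ev-ifz a b c hp hq (suc (suc n)) =
  ev-RecS {a = a} {n = suc n} (ev-ifz a b c hp hq (suc n)) (ev-Comp (ev-fst-pair a (pair (suc n) c)) hq)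

realise  : ∀ {n} (e : Exp n) → Realised ⟦ e ⟧
realise* : ∀ {n k} (es : Vec (Exp n) k) → Realised (λ ρ → env (⟦ es ⟧* ρ))

realise (var i) = realise-lookup i
realise (lit c) = constP c , λ ρ → ev-const c (env ρ)
realise (sucE e) with realise e
... | p , h = Comp S p , λ ρ → ev-Comp (h ρ) (ev-S _)
realise (pairE d e) with realise d | realise e
... | p , h | q , k = PairF p q , λ ρ → ev-PairF {a = ⟦ d ⟧ ρ} (h ρ) (k ρ)
realise (fstE e) with realise e
... | p , h = Comp Fst p , λ ρ → ev-Comp (h ρ) (ev-Fst _)
realise (sndE e) with realise e
... | p , h = Comp Snd p , λ ρ → ev-Comp (h ρ) (ev-Snd _)
realise (ifzE c d e) with realise c | realise d | realise e
... | p , h | q , k | r , l = Comp (Rec q (Comp r Fst)) (PairF I p) , λ ρ →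
  ev-Comp (ev-PairF {a = env ρ} (ev-I _) (h ρ)) (ev-ifz (env ρ) (⟦ d ⟧ ρ) (⟦ e ⟧ ρ) (k ρ) (l ρ) (⟦ c ⟧ ρ))
realise (recE b s e) with realise b | realise s | realise e
... | p , h | q , k | r , l = Comp (Rec p (Comp q rotate)) (PairF I r) , λ ρ →
  ev-Comp (ev-PairF {a = env ρ} (ev-I _) (l ρ))
    (ev-natrec (env ρ) (⟦ b ⟧ ρ) (λ i x → ⟦ s ⟧ (i ∷ x ∷ ρ)) (h ρ) (λ i x → k (i ∷ x ∷ ρ)) (⟦ e ⟧ ρ))
realise (call F (p , h) es) with realise* es
... | q , k = Comp p q , λ ρ → ev-Comp (k ρ) (h (⟦ es ⟧* ρ))

realise* []       = Z , λ ρ → ev-Z (env ρ)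
realise* (e ∷ es) with realise e | realise* es
... | p , h | q , k = PairF p q , λ ρ → ev-PairF {a = ⟦ e ⟧ ρ} (h ρ) (k ρ)

realise-ext : ∀ {n} {F G : Vec ℕ n → ℕ} → (∀ ρ → F ρ ≡ G ρ) → Realised F → Realised G
realise-ext eq (p , h) = p , λ ρ → subst (Eval p (env ρ)) (eq ρ) (h ρ)

realise-unary : ∀ {F : Vec ℕ 1 → ℕ} → Realised F → ∃[ p ] ∀ x → Eval p x (F (x ∷ []))
realise-unary (p , h) = Comp p (PairF I Z) , λ x → ev-Comp (ev-PairF {a = x} (ev-I x) (ev-Z x)) (h (x ∷ []))

on₁ : (ℕ → ℕ) → Vec ℕ 1 → ℕ
on₁ F (a ∷ []) = F a

on₂ : (ℕ → ℕ → ℕ) → Vec ℕ 2 → ℕ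
on₂ F (a ∷ b ∷ []) = F a b

pred-realised : Realised (on₁ pred)
pred-realised = realise-ext (λ { (zero ∷ []) → ≡.refl ; (suc a ∷ []) → ≡.refl })
  (realise (recE (lit 0) (var (# 0)) (var (# 0))))

predE : ∀ {n} → Exp n → Exp n
predE e = call (on₁ pred) pred-realised (e ∷ [])

∸-realised : Realised (on₂ _∸_)
∸-realised = realise-ext (λ { (a ∷ b ∷ []) → go a b }) (realise (recE (var (# 0)) (predE (var (# 1))) (var (# 1))))
  where
  go : ∀ a b → natrec a (λ _ → pred) b ≡ a ∸ b
  go a zero    = ≡.refl
  go a (suc b) = ≡.trans (cong pred (go a b)) (pred[m∸n]≡m∸[1+n] a b)

infixl 6 _∸E_ _+E_
_∸E_ _+E_ : ∀ {n} → Exp n → Exp n → Exp n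
a ∸E b = call (on₂ _∸_) ∸-realised (a ∷ b ∷ [])

+-realised : Realised (on₂ _+_)
+-realised = realise-ext (λ { (a ∷ b ∷ []) → go a b }) (realise (recE (var (# 1)) (sucE (var (# 1))) (var (# 0))))
  where
  go : ∀ a b → natrec b (λ _ → suc) a ≡ a + b
  go zero    b = ≡.refl
  go (suc a) b = cong suc (go a b)

a +E b = call (on₂ _+_) +-realised (a ∷ b ∷ [])

ifeq : ℕ → ℕ → ℕ → ℕ → ℕ
ifeq a b c d = ifz ((a ∸ b) + (b ∸ a)) c d

ifeqE : ∀ {n} → Exp n → Exp n → Exp n → Exp n → Exp n
ifeqE a b c d = ifzE ((a ∸E b) +E (b ∸E a)) c d

ifeq-≡ : ∀ {a b} c d → a ≡ b → ifeq a b c d ≡ c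
ifeq-≡ {a} c d ≡.refl rewrite n∸n≡0 a = ≡.refl

ifeq-≢ : ∀ {a b} c d → a ≢ b → ifeq a b c d ≡ d
ifeq-≢ {a} {b} c d a≢b with (a ∸ b) + (b ∸ a) in eq
... | suc _ = ≡.refl
... | zero  = ⊥-elim (a≢b (≤-antisym (m∸n≡0⇒m≤n (m+n≡0⇒m≡0 (a ∸ b) eq)) (m∸n≡0⇒m≤n (m+n≡0⇒n≡0 (a ∸ b) eq))))

-- Effective enumeration of inductively defined sets of facts

unenv : ∀ n → ℕ → Vec ℕ n
unenv zero    m = []
unenv (suc n) m = fst m ∷ unenv n (snd m)

unenv-env : ∀ {n} (ρ : Vec ℕ n) → unenv n (env ρ) ≡ ρ
unenv-env []      = ≡.refl
unenv-env {suc n} (x ∷ ρ) = cong₂ _∷_ (fst-pair x (env ρ))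
  (≡.trans (cong (unenv n) (snd-pair x (env ρ))) (unenv-env ρ))

envE : ∀ {n k} → Vec (Exp n) k → Exp n
envE []       = lit 0
envE (e ∷ es) = pairE e (envE es)

⟦envE⟧ : ∀ {n k} (es : Vec (Exp n) k) ρ → ⟦ envE es ⟧ ρ ≡ env (⟦ es ⟧* ρ)
⟦envE⟧ []       ρ = ≡.refl
⟦envE⟧ (e ∷ es) ρ = cong (pair (⟦ e ⟧ ρ)) (⟦envE⟧ es ρ)

unenvE : ∀ {n} k → Exp n → Vec (Exp n) k
unenvE zero    e = []
unenvE (suc k) e = fstE e ∷ unenvE k (sndE e)

-- A fact is a tag followed by four arguments; the zero vector is the trivial fact.
Fact : Set
Fact = Vec ℕ 5

-- Rules see sixteen variables: their own number, four hints, two premises and a parameter.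
Context : ℕ → Vec ℕ 5 → Fact → Fact → Vec ℕ 16
Context x h p q = h ++ p ++ q ++ x ∷ []

record Rule : Set where
  constructor _⊢_
  field
    guards     : List (Exp 16 × Exp 16)
    conclusion : Vec (Exp 16) 5
open Rule public

Holds : ∀ {n} → List (Exp n × Exp n) → Vec ℕ n → Set
Holds []             ρ = ⊤
Holds ((a , b) ∷ gs) ρ = ⟦ a ⟧ ρ ≡ ⟦ b ⟧ ρ × Holds gs ρ

guarded : ∀ {n} → List (Exp n × Exp n) → Exp n → Exp n → Exp n
guarded []             e d = e
guarded ((a , b) ∷ gs) e d = ifeqE a b (guarded gs e d) d

guarded-holds : ∀ {n} gs (e d : Exp n) ρ → Holds gs ρ → ⟦ guarded gs e d ⟧ ρ ≡ ⟦ e ⟧ ρ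
guarded-holds []             e d ρ _        = ≡.refl
guarded-holds ((a , b) ∷ gs) e d ρ (h , hs) = ≡.trans (ifeq-≡ _ _ h) (guarded-holds gs e d ρ hs)

guarded-cases : ∀ {n} gs (e d : Exp n) ρ →
  (Holds gs ρ × ⟦ guarded gs e d ⟧ ρ ≡ ⟦ e ⟧ ρ) ⊎ (¬ Holds gs ρ × ⟦ guarded gs e d ⟧ ρ ≡ ⟦ d ⟧ ρ)
guarded-cases []             e d ρ = inj₁ (tt , ≡.refl)
guarded-cases ((a , b) ∷ gs) e d ρ with ⟦ a ⟧ ρ ≟ ⟦ b ⟧ ρ
... | no a≢b = inj₂ ((λ h → a≢b (proj₁ h)) , ifeq-≢ _ _ a≢b)
... | yes a≡b with guarded-cases gs e d ρ
...   | inj₁ (hs , eq)  = inj₁ ((a≡b , hs) , ≡.trans (ifeq-≡ _ _ a≡b) eq)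
...   | inj₂ (¬hs , eq) = inj₂ ((λ h → ¬hs (proj₂ h)) , ≡.trans (ifeq-≡ _ _ a≡b) eq)

ruleE : Rule → Exp 16
ruleE (gs ⊢ out) = guarded gs (envE out) (lit 0)

switchE : ∀ {k} → Vec Rule k → Exp 16 → Exp 16
switchE []       i = lit 0
switchE (r ∷ rs) i = ifzE i (ruleE r) (switchE rs (predE i))

switch-lookup : ∀ {k} (rs : Vec Rule k) j i ρ → ⟦ i ⟧ ρ ≡ toℕ j → ⟦ switchE rs i ⟧ ρ ≡ ⟦ ruleE (lookup rs j) ⟧ ρ
switch-lookup (r ∷ rs) zero    i ρ eq rewrite eq = ≡.refl
switch-lookup (r ∷ rs) (suc j) i ρ eq with ⟦ i ⟧ ρ in eq′
... | suc m = switch-lookup rs j (predE i) ρ (≡.trans (cong pred eq′) (suc-injective eq))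

switch-cases : ∀ {k} (rs : Vec Rule k) i ρ →
  (∃[ j ] ⟦ switchE rs i ⟧ ρ ≡ ⟦ ruleE (lookup rs j) ⟧ ρ) ⊎ ⟦ switchE rs i ⟧ ρ ≡ 0
switch-cases []       i ρ = inj₂ ≡.refl
switch-cases (r ∷ rs) i ρ with ⟦ i ⟧ ρ
... | zero = inj₁ (zero , ≡.refl)
... | suc _ with switch-cases rs (predE i) ρ
...   | inj₁ (j , eq) = inj₁ (suc j , eq)
...   | inj₂ eq       = inj₂ eq

module Enumeration {k} (rules : Vec Rule k) where

  apply : ℕ → ℕ → ℕ → ℕ → ℕ
  apply x h p q = ⟦ switchE rules (var (# 0)) ⟧ (Context x (unenv 5 h) (unenv 5 p) (unenv 5 q))

  applyE : ∀ {n} → Exp n → Exp n → Exp n → Exp n → Exp n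
  applyE x h p q = call ⟦ switchE rules (var (# 0)) ⟧ (realise (switchE rules (var (# 0))))
    (unenvE 5 h ++ unenvE 5 p ++ unenvE 5 q ++ x ∷ [])

  -- `L` lists the first `i` facts, latest first, so dropping `i ∸ suc j` of them brings fact `j` to
  -- the head.
  recall : ℕ → ℕ → ℕ → ℕ
  recall L i j = fst (natrec L (λ _ → snd) (i ∸ suc j))

  recallE : ∀ {n} → Exp n → Exp n → Exp n → Exp n
  recallE L i j = fstE (recE L (sndE (var (# 1))) (i ∸E sucE j))

  -- Stage i + 1 applies the rule and hints coded by the first component of i
  -- to two facts enumerated earlier, recalled from the list L of all of them.
  next : ℕ → ℕ → ℕ → ℕ
  next x i L = apply x (fst (pred i)) (recall L i (fst (snd (pred i)))) (recall L i (snd (snd (pred i))))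

  nextE : ∀ {n} → Exp n → Exp n → Exp n → Exp n
  nextE x i L = applyE x (fstE (predE i)) (recallE L i (fstE (sndE (predE i)))) (recallE L i (sndE (sndE (predE i))))

  history : ℕ → ℕ → ℕ
  history x = natrec 0 (λ i L → pair (next x i L) L)

  history-drop : ∀ x d j → natrec (history x (d + j)) (λ _ → snd) d ≡ history x j
  history-drop x zero    j = ≡.refl
  history-drop x (suc d) j = ≡.trans (shift d) (≡.trans (cong (λ L → natrec L (λ _ → snd) d) (snd-pair (next x (d + j) (history x (d + j))) (history x (d + j)))) (history-drop x d j))
    where
    shift : ∀ {L} d → natrec L (λ _ → snd) (suc d) ≡ natrec (snd L) (λ _ → snd) d
    shift zero    = ≡.refl
    shift (suc d) = cong snd (shift d)

  -- Unfolding factCode at a numeral would run the enumeration.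
  opaque
    factCode : ℕ → ℕ → ℕ
    factCode x n = fst (history x (suc n))

    factCode-realised : Realised (on₂ factCode)
    factCode-realised = realise-ext (λ { (x ∷ n ∷ []) → ≡.refl })
      (realise (fstE (recE (lit 0) (pairE (nextE (var (# 2)) (var (# 0)) (var (# 1))) (var (# 1))) (sucE (var (# 1))))))

    factCode-next : ∀ x n → factCode x n ≡ next x n (history x n)
    factCode-next x n = fst-pair (next x n (history x n)) (history x n)

    recall-history : ∀ x {i j} → j < i → recall (history x i) i j ≡ factCode x j
    recall-history x {i} {j} j<i = cong fst
      (subst (λ m → natrec (history x m) (λ _ → snd) (i ∸ suc j) ≡ history x (suc j)) (m∸n+n≡m j<i)
        (history-drop x (i ∸ suc j) (suc j)))

  fact : ℕ → ℕ → Fact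
  fact x n = unenv 5 (factCode x n)

  factE : ∀ {n} → Exp n → Exp n → Vec (Exp n) 5
  factE x n = unenvE 5 (call (on₂ factCode) factCode-realised (x ∷ n ∷ []))

  -- Rule induction. A stage outputs either the conclusion of a rule whose guards hold, or the
  -- trivial fact when a guard fails or the rule number is out of range. The trivial fact also
  -- serves as both premises at stage `0`.
  fact-sound : ∀ x (V : Fact → Set) → V (unenv 5 0) →
    (∀ h p q → All (λ r → Holds (guards r) (Context x h p q) → V p → V q → V (⟦ conclusion r ⟧* (Context x h p q))) rules) →
    ∀ n → V (fact x n)
  fact-sound x V v₀ step n = all n n ≤-refl
    where
    v-recall : ∀ i j → j ≤ pred i → (∀ m → m < i → V (fact x m)) → V (unenv 5 (recall (history x i) i j))
    v-recall zero    .0 z≤n _ = v₀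
    v-recall (suc i) j  j≤i h = subst (λ c → V (unenv 5 c)) (≡.sym (recall-history x (s≤s j≤i))) (h j (s≤s j≤i))

    v-apply : ∀ h p q → V (unenv 5 p) → V (unenv 5 q) → V (unenv 5 (apply x h p q))
    v-apply h p q vp vq with switch-cases rules (var (# 0)) (Context x (unenv 5 h) (unenv 5 p) (unenv 5 q))
    ... | inj₂ eq = subst (λ c → V (unenv 5 c)) (≡.sym eq) v₀
    ... | inj₁ (j , eq) with lookup rules j | lookup⁺ (step (unenv 5 h) (unenv 5 p) (unenv 5 q)) j
    ...   | gs ⊢ out | st with guarded-cases gs (envE out) (lit 0) (Context x (unenv 5 h) (unenv 5 p) (unenv 5 q))
    ...     | inj₂ (_ , eq′) = subst (λ c → V (unenv 5 c)) (≡.sym (≡.trans eq eq′)) v₀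
    ...     | inj₁ (hs , eq′) = subst V
      (≡.sym (≡.trans (cong (unenv 5) (≡.trans eq (≡.trans eq′ (⟦envE⟧ out _)))) (unenv-env (⟦ out ⟧* _))))
      (st hs vp vq)

    -- The bound `b` makes this strong induction on stages structurally recursive.
    all : ∀ b m → m ≤ b → V (fact x m)
    all-below : ∀ b m → m ≤ b → ∀ l → l < m → V (fact x l)

    all b m m≤b = subst (λ c → V (unenv 5 c)) (≡.sym (factCode-next x m))
      (v-apply (fst (pred m)) (recall (history x m) m (fst (snd (pred m)))) (recall (history x m) m (snd (snd (pred m))))
        (v-recall m _ (≤-trans (fst≤ _) (snd≤ (pred m))) (all-below b m m≤b))
        (v-recall m _ (≤-trans (snd≤ _) (snd≤ (pred m))) (all-below b m m≤b)))

    all-below zero    .0 z≤n l ()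
    all-below (suc b) m  m≤b l l<m = all b l (≤-pred (≤-trans l<m m≤b))

  record Derivable (x : ℕ) (φ : Fact) : Set where
    constructor _,_
    field
      stage   : ℕ
      fact≡   : fact x stage ≡ φ

  -- The stage is the successor of the code of the rule number, the hints and the two premise
  -- stages. A pair is at least as large as its components, so both premises occur strictly earlier
  -- and can be recalled.
  fact-complete : ∀ x j h₁ h₂ h₃ h₄ {p q} → Derivable x p → Derivable x q →
    let ρ = Context x (toℕ j ∷ h₁ ∷ h₂ ∷ h₃ ∷ h₄ ∷ []) p q in
    Holds (guards (lookup rules j)) ρ → Derivable x (⟦ conclusion (lookup rules j) ⟧* ρ)
  fact-complete x j h₁ h₂ h₃ h₄ (n₁ , ≡.refl) (n₂ , ≡.refl) hs = suc n ,
    ≡.trans (cong (unenv 5) value) (unenv-env (⟦ conclusion (lookup rules j) ⟧* ρ))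
    where
    hv = toℕ j ∷ h₁ ∷ h₂ ∷ h₃ ∷ h₄ ∷ []
    ρ = Context x hv (fact x n₁) (fact x n₂)
    n = pair (env hv) (pair n₁ n₂)
    rec₁ : recall (history x (suc n)) (suc n) (fst (snd n)) ≡ factCode x n₁
    rec₁ = ≡.trans
      (cong (recall (history x (suc n)) (suc n)) (≡.trans (cong fst (snd-pair (env hv) (pair n₁ n₂))) (fst-pair n₁ n₂)))
      (recall-history x (s≤s (≤-trans (a≤pair n₁ n₂) (b≤pair (env hv) (pair n₁ n₂)))))
    rec₂ : recall (history x (suc n)) (suc n) (snd (snd n)) ≡ factCode x n₂
    rec₂ = ≡.trans
      (cong (recall (history x (suc n)) (suc n)) (≡.trans (cong snd (snd-pair (env hv) (pair n₁ n₂))) (snd-pair n₁ n₂)))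
      (recall-history x (s≤s (≤-trans (b≤pair n₁ n₂) (b≤pair (env hv) (pair n₁ n₂)))))
    inputs : Context x (unenv 5 (fst n)) (unenv 5 (recall (history x (suc n)) (suc n) (fst (snd n))))
                       (unenv 5 (recall (history x (suc n)) (suc n) (snd (snd n)))) ≡ ρ
    inputs = ≡.trans
      (cong₂ (λ a b → Context x (unenv 5 (fst n)) (unenv 5 a) (unenv 5 b)) rec₁ rec₂)
      (cong (λ h → Context x h (fact x n₁) (fact x n₂))
        (≡.trans (cong (unenv 5) (fst-pair (env hv) (pair n₁ n₂))) (unenv-env hv)))
    value : factCode x (suc n) ≡ env (⟦ conclusion (lookup rules j) ⟧* ρ)
    value = ≡.trans (factCode-next x (suc n)) (≡.trans (cong ⟦ switchE rules (var (# 0)) ⟧ inputs)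
      (≡.trans (switch-lookup rules j (var (# 0)) ρ ≡.refl)
        (≡.trans (guarded-holds (guards (lookup rules j)) (envE (conclusion (lookup rules j))) (lit 0) ρ hs) (⟦envE⟧ (conclusion (lookup rules j)) ρ))))

  -- A filler premise for rules that consult fewer than two.
  some-fact : ℕ → Fact
  some-fact x = fact x 0

  some-fact-derivable : ∀ x → Derivable x (some-fact x)
  some-fact-derivable x = 0 , ≡.refl

  fact-complete₁ : ∀ x j h₁ h₂ h₃ h₄ {p} → Derivable x p →
    let ρ = Context x (toℕ j ∷ h₁ ∷ h₂ ∷ h₃ ∷ h₄ ∷ []) p (some-fact x) in
    Holds (guards (lookup rules j)) ρ → Derivable x (⟦ conclusion (lookup rules j) ⟧* ρ)
  fact-complete₁ x j h₁ h₂ h₃ h₄ d = fact-complete x j h₁ h₂ h₃ h₄ d (some-fact-derivable x)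

  fact-complete₀ : ∀ x j h₁ h₂ h₃ h₄ →
    let ρ = Context x (toℕ j ∷ h₁ ∷ h₂ ∷ h₃ ∷ h₄ ∷ []) (some-fact x) (some-fact x) in
    Holds (guards (lookup rules j)) ρ → Derivable x (⟦ conclusion (lookup rules j) ⟧* ρ)
  fact-complete₀ x j h₁ h₂ h₃ h₄ = fact-complete₁ x j h₁ h₂ h₃ h₄ (some-fact-derivable x)

-- Coding of terms and substitution for the generator.

next-term : Term → Term
next-term x₀    = f x₀
next-term (f t) = g t
-- The outermost symbol is the lowest digit in bijective base 2: a digit 2 becomes 1 and carries.
next-term (g t) = f (next-term t)

decodeTerm : ℕ → Term
decodeTerm zero    = x₀
decodeTerm (suc n) = next-term (decodeTerm n)

encode-next-term : ∀ t → encodeTerm (next-term t) ≡ suc (encodeTerm t)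
encode-next-term x₀    = ≡.refl
encode-next-term (f t) = ≡.refl
encode-next-term (g t) rewrite encode-next-term t = cong suc (*-suc 2 (encodeTerm t))

encode-decodeTerm : ∀ n → encodeTerm (decodeTerm n) ≡ n
encode-decodeTerm zero    = ≡.refl
encode-decodeTerm (suc n) = ≡.trans (encode-next-term (decodeTerm n)) (cong suc (encode-decodeTerm n))

decode-f : ∀ n → decodeTerm (1 + 2 * n) ≡ f (decodeTerm n)
decode-f zero    = ≡.refl
decode-f (suc n) rewrite +-suc n (n + 0) = cong (λ t → next-term (next-term t)) (decode-f n)

decode-g : ∀ n → decodeTerm (2 + 2 * n) ≡ g (decodeTerm n)
decode-g n = cong next-term (decode-f n)

decode-encodeTerm : ∀ t → decodeTerm (encodeTerm t) ≡ t
decode-encodeTerm x₀    = ≡.refl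
decode-encodeTerm (f t) = ≡.trans (decode-f (encodeTerm t)) (cong f (decode-encodeTerm t))
decode-encodeTerm (g t) = ≡.trans (decode-g (encodeTerm t)) (cong g (decode-encodeTerm t))

codePair-decode : ∀ n → codePair (decodeTerm (fst n)) (decodeTerm (snd n)) ≡ n
codePair-decode n = ≡.trans (cong₂ pair (encode-decodeTerm (fst n)) (encode-decodeTerm (snd n))) (pair-unpair n)

infix 30 _[_]
_[_] : Term → Term → Term
x₀  [ t ] = t
f s [ t ] = f (s [ t ])
g s [ t ] = g (s [ t ])

[]-identity : ∀ s → s [ x₀ ] ≡ s
[]-identity x₀    = ≡.refl
[]-identity (f s) = cong f ([]-identity s)
[]-identity (g s) = cong g ([]-identity s)

[]-assoc : ∀ s t u → s [ t ] [ u ] ≡ s [ t [ u ] ]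
[]-assoc x₀    t u = ≡.refl
[]-assoc (f s) t u = cong f ([]-assoc s t u)
[]-assoc (g s) t u = cong g ([]-assoc s t u)

≡⇒Cong : ∀ {e s t} → s ≡ t → Cong e s t
≡⇒Cong ≡.refl = refl

[]-cong : ∀ {e} s {t u} → Cong e t u → Cong e (s [ t ]) (s [ u ])
[]-cong x₀    c = c
[]-cong (f s) c = f-cong ([]-cong s c)
[]-cong (g s) c = g-cong ([]-cong s c)

-- Isomorphisms as pairs of mutually inverse substitutions.

SendsRelations : ℕ → ℕ → Term → Set
SendsRelations e i t = ∀ s s′ → W e (codePair s s′) → Cong i (s [ t ]) (s′ [ t ])

[]-hom : ∀ {e i t} → SendsRelations e i t → ∀ {s s′} → Cong e s s′ → Cong i (s [ t ]) (s′ [ t ])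
[]-hom h (gen w)     = h _ _ w
[]-hom h refl        = refl
[]-hom h (sym c)     = sym ([]-hom h c)
[]-hom h (trans c d) = trans ([]-hom h c) ([]-hom h d)
[]-hom h (f-cong c)  = f-cong ([]-hom h c)
[]-hom h (g-cong c)  = g-cong ([]-hom h c)

MutuallyInverse : ℕ → ℕ → Term → Term → Set
MutuallyInverse e i t u =
  SendsRelations e i t × SendsRelations i e u × Cong e (t [ u ]) x₀ × Cong i (u [ t ]) x₀

inverse⇒≅ : ∀ {e i t u} → MutuallyInverse e i t u → UF²₁ e ≅ UF²₁ i
inverse⇒≅ {e} {i} {t} {u} (ht , hu , tu , ut) = record
  { to = _[ t ] ; from = _[ u ]
  ; to-cong = []-hom ht ; from-cong = []-hom hu
  ; to-F = λ _ → refl ; to-G = λ _ → refl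
  ; from-to = round-trip e t u tu
  ; to-from = round-trip i u t ut
  }
  where
  round-trip : ∀ e t u → Cong e (t [ u ]) x₀ → ∀ s → Cong e (s [ t ] [ u ]) s
  round-trip e t u c s = trans (≡⇒Cong ([]-assoc s t u)) (trans ([]-cong s c) (≡⇒Cong ([]-identity s)))

module _ {e i} (iso : UF²₁ e ≅ UF²₁ i) where
  open _≅_ iso

  -- The algebra is generated by `x₀`, so a homomorphism is determined by its value there.
  to-[] : ∀ s → Cong i (to s) (s [ to x₀ ])
  to-[] x₀    = refl
  to-[] (f s) = trans (to-F s) (f-cong (to-[] s))
  to-[] (g s) = trans (to-G s) (g-cong (to-[] s))

  to-sends : SendsRelations e i (to x₀)
  to-sends s s′ w = trans (sym (to-[] s)) (trans (to-cong (gen w)) (to-[] s′))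

≅-sym : ∀ {e i} → UF²₁ e ≅ UF²₁ i → UF²₁ i ≅ UF²₁ e
≅-sym iso = record
  { to = from ; from = to ; to-cong = from-cong ; from-cong = to-cong
  ; to-F = λ b → trans (from-cong (sym (trans (to-F (from b)) (f-cong (to-from b))))) (from-to (f (from b)))
  ; to-G = λ b → trans (from-cong (sym (trans (to-G (from b)) (g-cong (to-from b))))) (from-to (g (from b)))
  ; from-to = to-from ; to-from = from-to
  }
  where open _≅_ iso

≅⇒inverse : ∀ {e i} → UF²₁ e ≅ UF²₁ i → ∃[ t ] ∃[ u ] MutuallyInverse e i t u
≅⇒inverse iso = to x₀ , from x₀ , to-sends iso , to-sends (≅-sym iso) ,
  trans (sym (to-[] (≅-sym iso) (to x₀))) (from-to x₀) ,
  trans (sym (to-[] iso (from x₀))) (to-from x₀)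
  where open _≅_ iso

-- Facts about computations and about provable equality

h₁ h₂ h₃ p₀ p₁ p₂ p₃ p₄ q₀ q₁ q₂ q₃ q₄ param : Exp 16
h₁ = var (# 1)
h₂ = var (# 2)
h₃ = var (# 3)
p₀ = var (# 5)
p₁ = var (# 6)
p₂ = var (# 7)
p₃ = var (# 8)
p₄ = var (# 9)
q₀ = var (# 10)
q₁ = var (# 11)
q₂ = var (# 12)
q₃ = var (# 13)
q₄ = var (# 14)
param = var (# 15)

⟨_,_,_,_,_⟩ : ∀ {a} {A : Set a} → A → A → A → A → A → Vec A 5
⟨ a , b , c , d , e ⟩ = a ∷ b ∷ c ∷ d ∷ e ∷ []

double fourfold : ∀ {n} → Exp n → Exp n
double e   = e +E (e +E lit 0)
fourfold e = e +E (e +E (e +E (e +E lit 0)))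

infixl 6 _plus_
_plus_ : ∀ {n} → ℕ → Exp n → Exp n
zero plus e  = e
suc k plus e = sucE (k plus e)

pattern Computes e x y       = 1 ∷ e ∷ x ∷ y ∷ 0 ∷ []
pattern PositiveBelow p a m  = 2 ∷ p ∷ a ∷ m ∷ 0 ∷ []
pattern EqualAt e t s r      = 3 ∷ e ∷ t ∷ s ∷ r ∷ []
pattern PairEqualAt e t n    = 4 ∷ e ∷ t ∷ n ∷ 0 ∷ []

-- The first twelve rules are the constructors of Eval, the rule for Mu being split in three.
universalRules : Vec Rule 19
universalRules =
    ([] ⊢ ⟨ lit 1 , lit 0 , h₁ , lit 0 , lit 0 ⟩)
  ∷ ([] ⊢ ⟨ lit 1 , lit 1 , h₁ , sucE h₁ , lit 0 ⟩)
  ∷ ([] ⊢ ⟨ lit 1 , lit 2 , h₁ , h₁ , lit 0 ⟩)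
  ∷ ([] ⊢ ⟨ lit 1 , lit 3 , h₁ , fstE h₁ , lit 0 ⟩)
  ∷ ([] ⊢ ⟨ lit 1 , lit 4 , h₁ , sndE h₁ , lit 0 ⟩)
  ∷ (((p₀ , lit 1) ∷ (q₀ , lit 1) ∷ (p₃ , q₂) ∷ []) ⊢
     ⟨ lit 1 , 5 plus fourfold (pairE q₁ p₁) , p₂ , q₃ , lit 0 ⟩)
  ∷ (((p₀ , lit 1) ∷ (q₀ , lit 1) ∷ (p₂ , q₂) ∷ []) ⊢
     ⟨ lit 1 , 6 plus fourfold (pairE p₁ q₁) , p₂ , pairE p₃ q₃ , lit 0 ⟩)
  ∷ (((p₀ , lit 1) ∷ []) ⊢
     ⟨ lit 1 , 7 plus fourfold (pairE p₁ h₁) , pairE p₂ (lit 0) , p₃ , lit 0 ⟩)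
  ∷ (((p₀ , lit 1) ∷ (q₀ , lit 1) ∷ (p₁ , 7 plus fourfold (pairE h₁ q₁)) ∷
      (p₂ , pairE h₂ h₃) ∷ (q₂ , pairE h₂ (pairE h₃ p₃)) ∷ []) ⊢
     ⟨ lit 1 , p₁ , pairE h₂ (sucE h₃) , q₃ , lit 0 ⟩)
  ∷ ([] ⊢ ⟨ lit 2 , h₁ , h₂ , lit 0 , lit 0 ⟩)
  ∷ (((p₀ , lit 2) ∷ (q₀ , lit 1) ∷ (q₁ , p₁) ∷ (q₂ , pairE p₂ p₃) ∷ (q₃ , sucE h₁) ∷ []) ⊢
     ⟨ lit 2 , p₁ , p₂ , sucE p₃ , lit 0 ⟩)
  ∷ (((p₀ , lit 2) ∷ (q₀ , lit 1) ∷ (q₁ , p₁) ∷ (q₂ , pairE p₂ p₃) ∷ (q₃ , lit 0) ∷ []) ⊢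
     ⟨ lit 1 , 8 plus fourfold p₁ , p₂ , p₃ , lit 0 ⟩)
  -- Since `0` codes `x₀`, the facts `EqualAt e 0` express provable equality itself. Symmetry and
  -- the generating relations are stated there, and transitivity continues `s [ t ] = r` by such an
  -- equality.
  ∷ ([] ⊢ ⟨ lit 3 , h₁ , h₂ , lit 0 , h₂ ⟩)
  ∷ (((p₀ , lit 3) ∷ []) ⊢ ⟨ lit 3 , p₁ , p₂ , 1 plus double p₃ , 1 plus double p₄ ⟩)
  ∷ (((p₀ , lit 3) ∷ []) ⊢ ⟨ lit 3 , p₁ , p₂ , 2 plus double p₃ , 2 plus double p₄ ⟩)
  ∷ (((p₀ , lit 3) ∷ (q₀ , lit 3) ∷ (q₁ , p₁) ∷ (q₂ , lit 0) ∷ (q₃ , p₄) ∷ []) ⊢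
     ⟨ lit 3 , p₁ , p₂ , p₃ , q₄ ⟩)
  ∷ (((p₀ , lit 3) ∷ (p₂ , lit 0) ∷ []) ⊢ ⟨ lit 3 , p₁ , lit 0 , p₄ , p₃ ⟩)
  ∷ (((p₀ , lit 1) ∷ []) ⊢ ⟨ lit 3 , p₁ , lit 0 , fstE p₂ , sndE p₂ ⟩)
  ∷ (((p₀ , lit 3) ∷ (q₀ , lit 3) ∷ (q₁ , p₁) ∷ (q₂ , p₂) ∷ (q₄ , p₄) ∷ []) ⊢
     ⟨ lit 4 , p₁ , p₂ , pairE p₃ q₃ , lit 0 ⟩)
  ∷ []

module U = Enumeration universalRules

True : Fact → Set
True (1 ∷ e ∷ x ∷ y ∷ _ ∷ []) = Φ e x y
True (2 ∷ p ∷ a ∷ m ∷ _ ∷ []) = ∀ j → j < m → ∃[ k ] Φ p (pair a j) (suc k)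
True (3 ∷ e ∷ t ∷ s ∷ r ∷ []) = Cong e (decodeTerm s [ decodeTerm t ]) (decodeTerm r)
True (4 ∷ e ∷ t ∷ n ∷ _ ∷ []) = Cong e (decodeTerm (fst n) [ decodeTerm t ]) (decodeTerm (snd n) [ decodeTerm t ])
True _                        = ⊤

universal-step : ∀ h p q → All (λ r → Holds (guards r) (Context 0 h p q) → True p → True q →
                                      True (⟦ conclusion r ⟧* (Context 0 h p q))) universalRules
universal-step (_ ∷ h₁ ∷ h₂ ∷ h₃ ∷ h₄ ∷ []) (p₀ ∷ p₁ ∷ p₂ ∷ p₃ ∷ p₄ ∷ []) (q₀ ∷ q₁ ∷ q₂ ∷ q₃ ∷ q₄ ∷ []) =
    (λ _ _ _ → Z , ≡.refl , ev-Z _)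
  ∷ (λ _ _ _ → S , ≡.refl , ev-S _)
  ∷ (λ _ _ _ → I , ≡.refl , ev-I _)
  ∷ (λ _ _ _ → Fst , ≡.refl , ev-Fst _)
  ∷ (λ _ _ _ → Snd , ≡.refl , ev-Snd _)
  ∷ (λ { (≡.refl , ≡.refl , ≡.refl , _) (q , ≡.refl , d) (p , ≡.refl , d′) → Comp p q , ≡.refl , ev-Comp d d′ })
  ∷ (λ { (≡.refl , ≡.refl , ≡.refl , _) (p , ≡.refl , d) (q , ≡.refl , d′) →
         PairF p q , ≡.refl , ev-PairF {a = p₃} d d′ })
  -- The base case of a recursion does not run the step program, so its code is an arbitrary hint.
  ∷ (λ { (≡.refl , _) (p , ≡.refl , d) _ → let (q , eq) = encodeProg-surjective h₁ in
         Rec p q , cong (λ m → 7 + 4 * pair (encodeProg p) m) eq , ev-Rec0 d })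
  ∷ (λ { (≡.refl , ≡.refl , eq₁ , ≡.refl , ≡.refl , _) d d′ → step-Rec {p = h₁} {h₂} {h₃} {p₃} eq₁ d d′ })
  ∷ (λ _ _ _ _ ())
  ∷ (λ { (≡.refl , ≡.refl , ≡.refl , ≡.refl , ≡.refl , _) below c _ j< → extend {p₁} {p₂} below c (m≤n⇒m<n∨m≡n (≤-pred j<)) })
  ∷ (λ { (≡.refl , ≡.refl , ≡.refl , ≡.refl , ≡.refl , _) below (p , ≡.refl , d) →
         Mu p , ≡.refl , ev-Mu d (positive p {p₂} below) })
  ∷ (λ _ _ _ → refl)
  ∷ (λ { (≡.refl , _) c _ → subst₂ (λ s r → Cong p₁ (s [ decodeTerm p₂ ]) r)
         (≡.sym (decode-f p₃)) (≡.sym (decode-f p₄)) (f-cong c) })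
  ∷ (λ { (≡.refl , _) c _ → subst₂ (λ s r → Cong p₁ (s [ decodeTerm p₂ ]) r)
         (≡.sym (decode-g p₃)) (≡.sym (decode-g p₄)) (g-cong c) })
  ∷ (λ { (≡.refl , ≡.refl , ≡.refl , ≡.refl , ≡.refl , _) c c′ →
         trans c (trans (≡⇒Cong (≡.sym ([]-identity (decodeTerm p₄)))) c′) })
  ∷ (λ { (≡.refl , ≡.refl , _) c _ →
         trans (≡⇒Cong ([]-identity (decodeTerm p₄))) (trans (sym c) (≡⇒Cong ([]-identity (decodeTerm p₃)))) })
  ∷ (λ { (≡.refl , _) (p , ≡.refl , d) _ → trans (≡⇒Cong ([]-identity (decodeTerm (fst p₂))))
         (gen (p₃ , p , ≡.refl , subst (λ n → Eval p n p₃) (≡.sym (codePair-decode p₂)) d)) })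
  ∷ (λ { (≡.refl , ≡.refl , ≡.refl , ≡.refl , ≡.refl , _) c c′ →
         subst₂ (λ s s′ → Cong p₁ (decodeTerm s [ decodeTerm p₂ ]) (decodeTerm s′ [ decodeTerm p₂ ]))
           (≡.sym (fst-pair p₃ q₃)) (≡.sym (snd-pair p₃ q₃)) (trans c (sym c′)) })
  ∷ []
  where
  step-Rec : ∀ {r q p a n y z} → r ≡ 7 + 4 * pair p q → Φ r (pair a n) y → Φ q (pair a (pair n y)) z →
             Φ r (pair a (suc n)) z
  step-Rec {p = p} {a} {n} eq (r , ≡.refl , d) (q , ≡.refl , d′) with encodeProg-surjective p
  ... | p , ≡.refl with encodeProg-injective r (Rec p q) eq
  ...   | ≡.refl = Rec p q , ≡.refl , ev-RecS {a = a} {n = n} d d′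

  extend : ∀ {p a m k j} → (∀ j → j < m → ∃[ k ] Φ p (pair a j) (suc k)) → Φ p (pair a m) (suc k) →
           j < m ⊎ j ≡ m → ∃[ k ] Φ p (pair a j) (suc k)
  extend below c (inj₁ j<m)    = below _ j<m
  extend below c (inj₂ ≡.refl) = _ , c

  positive : ∀ p {a n} → (∀ j → j < n → ∃[ k ] Φ (encodeProg p) (pair a j) (suc k)) →
             ∀ m → m < n → ∃[ k ] Eval p (pair a m) (suc k)
  positive p below m m< with below m m<
  ... | k , p′ , eq , d with encodeProg-injective p′ p eq
  ...   | ≡.refl = k , d

universal-sound : ∀ {φ} → U.Derivable 0 φ → True φ
universal-sound (n U., ≡.refl) = U.fact-sound 0 True tt universal-step n

Eval-derivable : ∀ {p x y} → Eval p x y → U.Derivable 0 (Computes (encodeProg p) x y)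
positive-derivable : ∀ p a n → (∀ m → m < n → ∃[ k ] U.Derivable 0 (Computes (encodeProg p) (pair a m) (suc k))) →
                     U.Derivable 0 (PositiveBelow (encodeProg p) a n)

positive-derivable p a zero    h = U.fact-complete₀ 0 (# 9) _ _ 0 0 tt
positive-derivable p a (suc n) h with h n ≤-refl
... | k , d = U.fact-complete 0 (# 10) k 0 0 0 (positive-derivable p a n (λ m m<n → h m (m≤n⇒m≤1+n m<n))) d
                (≡.refl , ≡.refl , ≡.refl , ≡.refl , ≡.refl , tt)

Eval-derivable (ev-Z x) = U.fact-complete₀ 0 (# 0) x 0 0 0 tt
Eval-derivable (ev-S x) = U.fact-complete₀ 0 (# 1) x 0 0 0 tt
Eval-derivable (ev-I x) = U.fact-complete₀ 0 (# 2) x 0 0 0 tt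
Eval-derivable (ev-Fst x) = U.fact-complete₀ 0 (# 3) x 0 0 0 tt
Eval-derivable (ev-Snd x) = U.fact-complete₀ 0 (# 4) x 0 0 0 tt
Eval-derivable (ev-Comp d e) =
  U.fact-complete 0 (# 5) 0 0 0 0 (Eval-derivable d) (Eval-derivable e) (≡.refl , ≡.refl , ≡.refl , tt)
Eval-derivable (ev-PairF d e) =
  U.fact-complete 0 (# 6) 0 0 0 0 (Eval-derivable d) (Eval-derivable e) (≡.refl , ≡.refl , ≡.refl , tt)
Eval-derivable (ev-Rec0 {q = q} d) =
  U.fact-complete₁ 0 (# 7) (encodeProg q) 0 0 0 (Eval-derivable d) (≡.refl , tt)
Eval-derivable (ev-RecS {p} {q} {a} {n} d e) =
  U.fact-complete 0 (# 8) (encodeProg p) a n 0 (Eval-derivable d) (Eval-derivable e)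
    (≡.refl , ≡.refl , ≡.refl , ≡.refl , ≡.refl , tt)
Eval-derivable (ev-Mu {p} {a} {n} d h) =
  U.fact-complete 0 (# 11) 0 0 0 0
    (positive-derivable p a n (λ m m<n → proj₁ (h m m<n) , Eval-derivable (proj₂ (h m m<n))))
    (Eval-derivable d) (≡.refl , ≡.refl , ≡.refl , ≡.refl , ≡.refl , tt)

subst-derivable : ∀ e t s → U.Derivable 0 (EqualAt e (encodeTerm t) (encodeTerm s) (encodeTerm (s [ t ])))
subst-derivable e t x₀    = U.fact-complete₀ 0 (# 12) e (encodeTerm t) 0 0 tt
subst-derivable e t (f s) = U.fact-complete₁ 0 (# 13) 0 0 0 0 (subst-derivable e t s) (≡.refl , tt)
subst-derivable e t (g s) = U.fact-complete₁ 0 (# 14) 0 0 0 0 (subst-derivable e t s) (≡.refl , tt)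

Cong-derivable : ∀ {e s r} → Cong e s r → U.Derivable 0 (EqualAt e 0 (encodeTerm s) (encodeTerm r))
Cong-derivable {e} {s} {r} (gen (y , p , ≡.refl , d)) =
  subst₂ (λ a b → U.Derivable 0 (EqualAt e 0 a b)) (fst-pair (encodeTerm s) (encodeTerm r)) (snd-pair (encodeTerm s) (encodeTerm r))
    (U.fact-complete₁ 0 (# 17) 0 0 0 0 (Eval-derivable d) (≡.refl , tt))
-- Reflexivity comes from the substitution rules, by substituting `x₀`.
Cong-derivable {e} {s} refl =
  subst (λ r → U.Derivable 0 (EqualAt e 0 (encodeTerm s) (encodeTerm r))) ([]-identity s) (subst-derivable e x₀ s)
Cong-derivable (sym c) = U.fact-complete₁ 0 (# 16) 0 0 0 0 (Cong-derivable c) (≡.refl , ≡.refl , tt)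
Cong-derivable (trans c d) = U.fact-complete 0 (# 15) 0 0 0 0 (Cong-derivable c) (Cong-derivable d)
  (≡.refl , ≡.refl , ≡.refl , ≡.refl , ≡.refl , tt)
Cong-derivable (f-cong c) = U.fact-complete₁ 0 (# 13) 0 0 0 0 (Cong-derivable c) (≡.refl , tt)
Cong-derivable (g-cong c) = U.fact-complete₁ 0 (# 14) 0 0 0 0 (Cong-derivable c) (≡.refl , tt)

-- First the term `s [ t ]` is computed exactly, then it is replaced by a provably equal one.
EqualAt-derivable : ∀ {e s t r} → Cong e (s [ t ]) r → U.Derivable 0 (EqualAt e (encodeTerm t) (encodeTerm s) (encodeTerm r))
EqualAt-derivable {e} {s} {t} c = U.fact-complete 0 (# 15) 0 0 0 0 (subst-derivable e t s) (Cong-derivable c)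
  (≡.refl , ≡.refl , ≡.refl , ≡.refl , ≡.refl , tt)

PairEqualAt-derivable : ∀ {e s s′ t} → Cong e (s [ t ]) (s′ [ t ]) →
                        U.Derivable 0 (PairEqualAt e (encodeTerm t) (codePair s s′))
PairEqualAt-derivable {e} {s} {s′} {t} c = U.fact-complete 0 (# 18) 0 0 0 0 (subst-derivable e t s)
  (EqualAt-derivable {e} {s′} {t} (sym c))
  (≡.refl , ≡.refl , ≡.refl , ≡.refl , ≡.refl , tt)

-- Certificate checking and the upper bound.

zero-set-computable : ∀ {F : Vec ℕ 1 → ℕ} → Realised F → ComputablePred (λ n → F (n ∷ []) ≡ 0)
zero-set-computable {F} r with realise-unary r
... | p , h = encodeProg p , (λ n → F (n ∷ []) , p , ≡.refl , h n) , λ n → mk⇔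
  (λ eq → p , ≡.refl , subst (Eval p n) eq (h n))
  (λ { (p′ , eq , d) → value p′ eq d })
  where
  value : ∀ {n} p′ → encodeProg p′ ≡ encodeProg p → Eval p′ n 0 → F (n ∷ []) ≡ 0
  value {n} p′ eq d with encodeProg-injective p′ p eq
  ... | ≡.refl = Eval-deterministic (h n) d

equations : ∀ {n k} → Vec (Exp n) k → Vec (Exp n) k → List (Exp n × Exp n)
equations []       []       = []
equations (a ∷ as) (b ∷ bs) = (a , b) ∷ equations as bs

equations-hold : ∀ {n k} (as bs : Vec (Exp n) k) ρ → ⟦ as ⟧* ρ ≡ ⟦ bs ⟧* ρ → Holds (equations as bs) ρ
equations-hold []       []       ρ _  = tt
equations-hold (a ∷ as) (b ∷ bs) ρ eq = let (h , t) = ∷-injective eq in h , equations-hold as bs ρ t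

equations-solved : ∀ {n k} (as bs : Vec (Exp n) k) ρ → Holds (equations as bs) ρ → ⟦ as ⟧* ρ ≡ ⟦ bs ⟧* ρ
equations-solved []       []       ρ _        = ≡.refl
equations-solved (a ∷ as) (b ∷ bs) ρ (h , hs) = cong₂ _∷_ h (equations-solved as bs ρ hs)

module _ {n k} (as bs : Vec (Exp n) k) where

  differE : Exp n
  differE = guarded (equations as bs) (lit 0) (lit 1)

  differ≡0 : ∀ ρ → ⟦ as ⟧* ρ ≡ ⟦ bs ⟧* ρ → ⟦ differE ⟧ ρ ≡ 0
  differ≡0 ρ eq = guarded-holds (equations as bs) (lit 0) (lit 1) ρ (equations-hold as bs ρ eq)

  differ≡0⇒ : ∀ ρ → ⟦ differE ⟧ ρ ≡ 0 → ⟦ as ⟧* ρ ≡ ⟦ bs ⟧* ρ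
  differ≡0⇒ ρ eq with guarded-cases (equations as bs) (lit 0) (lit 1) ρ
  ... | inj₁ (hs , _) = equations-solved as bs ρ hs
  ... | inj₂ (_ , eq′) with ≡.trans (≡.sym eq) eq′
  ...   | ()

-- Zero iff the fact enumerated at c says s[t] = r in the algebra presented by e.
module _ where
  observed expected : Vec (Exp 5) 5
  observed = U.factE (lit 0) (var (# 4))
  expected = lit 3 ∷ var (# 0) ∷ var (# 1) ∷ var (# 2) ∷ var (# 3) ∷ []

  equalAtE : Exp 5
  equalAtE = differE observed expected

  equalAt : ∀ e t s r → Cong e (s [ t ]) r →
            ∃[ c ] ⟦ equalAtE ⟧ (e ∷ encodeTerm t ∷ encodeTerm s ∷ encodeTerm r ∷ c ∷ []) ≡ 0
  equalAt e t s r h = go (EqualAt-derivable {e} {s} {t} {r} h)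
    where
    go : U.Derivable 0 (EqualAt e (encodeTerm t) (encodeTerm s) (encodeTerm r)) → _
    go (c U., eq) = c , differ≡0 observed expected (e ∷ encodeTerm t ∷ encodeTerm s ∷ encodeTerm r ∷ c ∷ []) eq

  equalAt⇒ : ∀ e t s r c → ⟦ equalAtE ⟧ (e ∷ t ∷ s ∷ r ∷ c ∷ []) ≡ 0 →
             Cong e (decodeTerm s [ decodeTerm t ]) (decodeTerm r)
  equalAt⇒ e t s r c eq = universal-sound (c U., differ≡0⇒ observed expected (e ∷ t ∷ s ∷ r ∷ c ∷ []) eq)

-- Zero unless the fact enumerated at b puts some n into W e while the one at c is not
-- the image of the pair n under x₀ ↦ t.
module _ where
  relationFact imageFact expectedImage : Vec (Exp 5) 5
  relationFact        = U.factE (lit 0) (var (# 3))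
  imageFact         = U.factE (lit 0) (var (# 4))
  expectedImage = lit 4 ∷ var (# 1) ∷ var (# 2) ∷ lookup relationFact (# 2) ∷ lit 0 ∷ []

  isRelation : List (Exp 5 × Exp 5)
  isRelation = (lookup relationFact (# 0) , lit 1) ∷ (lookup relationFact (# 1) , var (# 0)) ∷ []

  sendsE : Exp 5
  sendsE = guarded isRelation (differE imageFact expectedImage) (lit 0)

  relationAt : ℕ → ℕ
  relationAt b = lookup (U.fact 0 b) (# 2)

  Sends : ℕ → ℕ → ℕ → ℕ → ℕ → Set
  Sends e i t b c = ⟦ sendsE ⟧ (e ∷ i ∷ t ∷ b ∷ c ∷ []) ≡ 0

  sends : ∀ e i t → SendsRelations e i t → ∀ b → ∃[ c ] Sends e i (encodeTerm t) b c
  -- The guards do not mention the witness, so deciding them at `0` decides them for every `c`.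
  sends e i t h b = go (guarded-cases isRelation (differE imageFact expectedImage) (lit 0) (ρ 0))
    where
    ρ : ℕ → Vec ℕ 5
    ρ c = e ∷ i ∷ encodeTerm t ∷ b ∷ c ∷ []
    n = relationAt b
    relation : ∀ {c} → Holds isRelation (ρ c) → W e n
    relation (tag , index , _) = lookup (U.fact 0 b) (# 3) , universal-sound {Computes′ (lookup (U.fact 0 b) (# 4))}
      (b U., cong₂ (λ x y → x ∷ y ∷ n ∷ lookup (U.fact 0 b) (# 3) ∷ lookup (U.fact 0 b) (# 4) ∷ []) tag index)
      where
      Computes′ : ℕ → Fact
      Computes′ z = 1 ∷ e ∷ n ∷ lookup (U.fact 0 b) (# 3) ∷ z ∷ []
    finish : Holds isRelation (ρ 0) → U.Derivable 0 (PairEqualAt i (encodeTerm t) n) → ∃[ c ] Sends e i (encodeTerm t) b c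
    finish hs (c U., eq) = c , ≡.trans
      (guarded-holds isRelation (differE imageFact expectedImage) (lit 0) (ρ c) hs)
      (differ≡0 imageFact expectedImage (ρ c) eq)
    go : _ ⊎ _ → ∃[ c ] Sends e i (encodeTerm t) b c
    go (inj₂ (_ , eq)) = 0 , eq
    go (inj₁ (hs , _)) = finish hs
      (subst (λ m → U.Derivable 0 (PairEqualAt i (encodeTerm t) m)) (codePair-decode n)
        (PairEqualAt-derivable {i} {decodeTerm (fst n)} {decodeTerm (snd n)} {t}
          (h _ _ (subst (W e) (≡.sym (codePair-decode n)) (relation {0} hs)))))

  -- Each relation in `W e` is enumerated at some stage `b`, and the witness for that `b` is a stage
  -- certifying its image.
  sends⇒ : ∀ e i t → (∀ b → ∃[ c ] Sends e i t b c) → SendsRelations e i (decodeTerm t)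
  sends⇒ e i t h s s′ (y , p , ≡.refl , d) = go (Eval-derivable d)
    where
    n = codePair s s′
    read : ∀ b c → U.fact 0 b ≡ Computes e n y → Sends e i t b c → U.fact 0 c ≡ PairEqualAt i t n
    read b c eq sat = ≡.trans
      (differ≡0⇒ imageFact expectedImage ρ
        (≡.trans (≡.sym (guarded-holds isRelation (differE imageFact expectedImage) (lit 0) ρ holds)) sat))
      (cong (λ φ → 4 ∷ i ∷ t ∷ lookup φ (# 2) ∷ 0 ∷ []) eq)
      where
      ρ = e ∷ i ∷ t ∷ b ∷ c ∷ []
      holds : Holds isRelation ρ
      holds = cong (λ φ → lookup φ (# 0)) eq , cong (λ φ → lookup φ (# 1)) eq , tt
    go : U.Derivable 0 (Computes e n y) → Cong i (s [ decodeTerm t ]) (s′ [ decodeTerm t ])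
    go (b U., eq) = subst₂ (λ a a′ → Cong i (a [ decodeTerm t ]) (a′ [ decodeTerm t ]))
      (≡.trans (cong decodeTerm (fst-pair (encodeTerm s) (encodeTerm s′))) (decode-encodeTerm s))
      (≡.trans (cong decodeTerm (snd-pair (encodeTerm s) (encodeTerm s′))) (decode-encodeTerm s′))
      (universal-sound {PairEqualAt i t n} (proj₁ (h b) U., read b (proj₁ (h b)) eq (proj₂ (h b))))

-- Variables e, i, t, u, b and four witnesses.
isoE : Exp 9
isoE = call ⟦ sendsE ⟧ (realise sendsE) (var (# 0) ∷ var (# 1) ∷ var (# 2) ∷ var (# 4) ∷ var (# 5) ∷ [])
    +E call ⟦ sendsE ⟧ (realise sendsE) (var (# 1) ∷ var (# 0) ∷ var (# 3) ∷ var (# 4) ∷ var (# 6) ∷ [])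
    +E call ⟦ equalAtE ⟧ (realise equalAtE) (var (# 0) ∷ var (# 3) ∷ var (# 2) ∷ lit 0 ∷ var (# 7) ∷ [])
    +E call ⟦ equalAtE ⟧ (realise equalAtE) (var (# 1) ∷ var (# 2) ∷ var (# 3) ∷ lit 0 ∷ var (# 8) ∷ [])

quadruple : ∀ {A : Set} → (ℕ → ℕ → ℕ → ℕ → A) → ℕ → A
quadruple k n = k (fst n) (fst (snd n)) (fst (snd (snd n))) (snd (snd (snd n)))

quadruple-pair : ∀ {A : Set} (k : ℕ → ℕ → ℕ → ℕ → A) a b c d →
                 quadruple k (pair a (pair b (pair c d))) ≡ k a b c d
quadruple-pair k a b c d = begin
  quadruple k (pair a (pair b (pair c d)))
    ≡⟨ cong₂ (λ x y → k x (fst y) (fst (snd y)) (snd (snd y))) (fst-pair a bcd) (snd-pair a bcd) ⟩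
  k a (fst bcd) (fst (snd bcd)) (snd (snd bcd))
    ≡⟨ cong₂ (λ x y → k a x (fst y) (snd y)) (fst-pair b (pair c d)) (snd-pair b (pair c d)) ⟩
  k a b (fst (pair c d)) (snd (pair c d))
    ≡⟨ cong₂ (k a b) (fst-pair c d) (snd-pair c d) ⟩
  k a b c d ∎
  where
  open ≡.≡-Reasoning
  bcd = pair b (pair c d)

quintuple : ∀ {A : Set} → (ℕ → ℕ → ℕ → ℕ → ℕ → A) → ℕ → A
quintuple k n = quadruple (k (fst n)) (snd n)

quintuple-pair : ∀ {A : Set} (k : ℕ → ℕ → ℕ → ℕ → ℕ → A) a b c d e →
                 quintuple k (pair a (pair b (pair c (pair d e)))) ≡ k a b c d e
quintuple-pair k a b c d e = ≡.trans
  (cong₂ (λ x y → quadruple (k x) y) (fst-pair a bcde) (snd-pair a bcde)) (quadruple-pair (k a) b c d e)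
  where bcde = pair b (pair c (pair d e))

isoCheck : ℕ → ℕ → ℕ → ℕ → ℕ → ℕ
isoCheck e i a b c =
  ⟦ isoE ⟧ (e ∷ i ∷ fst a ∷ snd a ∷ b ∷ fst c ∷ fst (snd c) ∷ fst (snd (snd c)) ∷ snd (snd (snd c)) ∷ [])

isoCheck-realised : Realised (on₁ (quintuple isoCheck))
isoCheck-realised = realise-ext (λ { (n ∷ []) → ≡.refl })
  (realise (call ⟦ isoE ⟧ (realise isoE)
    (fstE n ∷ fstE (sndE n) ∷ fstE a ∷ sndE a ∷ fstE (sndE (sndE (sndE n))) ∷
     fstE c ∷ fstE (sndE c) ∷ fstE (sndE (sndE c)) ∷ sndE (sndE (sndE c)) ∷ [])))
  where
  n a c : Exp 1
  n = var (# 0)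
  a = fstE (sndE (sndE n))
  c = sndE (sndE (sndE (sndE n)))

isoCheck-pairs : ∀ e i t u b c₁ c₂ c₃ c₄ → isoCheck e i (pair t u) b (pair c₁ (pair c₂ (pair c₃ c₄))) ≡
  ⟦ isoE ⟧ (e ∷ i ∷ t ∷ u ∷ b ∷ c₁ ∷ c₂ ∷ c₃ ∷ c₄ ∷ [])
isoCheck-pairs e i t u b c₁ c₂ c₃ c₄ = ≡.trans
  (cong₂ (λ t u → ⟦ isoE ⟧ (e ∷ i ∷ t ∷ u ∷ b ∷ fst c ∷ fst (snd c) ∷ fst (snd (snd c)) ∷ snd (snd (snd c)) ∷ []))
    (fst-pair t u) (snd-pair t u))
  (quadruple-pair (λ c₁ c₂ c₃ c₄ → ⟦ isoE ⟧ (e ∷ i ∷ t ∷ u ∷ b ∷ c₁ ∷ c₂ ∷ c₃ ∷ c₄ ∷ [])) c₁ c₂ c₃ c₄)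
  where c = pair c₁ (pair c₂ (pair c₃ c₄))

-- The outer witness holds the images of both generators, `b` runs over stages that may reveal a
-- relation of either side, and the inner witness collects four certificates. A sum of naturals
-- vanishes iff all summands do.
iso⇔ : ∀ e i → (e ≅UF²₁ i) ⇔
  (∃[ a ] ∀ b → ∃[ c ] quintuple isoCheck (pair e (pair i (pair a (pair b c)))) ≡ 0)
iso⇔ e i = mk⇔ (λ iso → forward (≅⇒inverse iso)) backward
  where
  unpack : ∀ a b c → quintuple isoCheck (pair e (pair i (pair a (pair b c)))) ≡ isoCheck e i a b c
  unpack a b c = quintuple-pair isoCheck e i a b c

  forward : ∃[ t ] ∃[ u ] MutuallyInverse e i t u →
            ∃[ a ] ∀ b → ∃[ c ] quintuple isoCheck (pair e (pair i (pair a (pair b c)))) ≡ 0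
  forward (t , u , ht , hu , tu , ut) = pair (encodeTerm t) (encodeTerm u) , λ b →
    combine b (sends e i t ht b) (sends i e u hu b) (equalAt e u t x₀ tu) (equalAt i t u x₀ ut)
    where
    combine : ∀ b → ∃[ c ] Sends e i (encodeTerm t) b c → ∃[ c ] Sends i e (encodeTerm u) b c →
      ∃[ c ] ⟦ equalAtE ⟧ (e ∷ encodeTerm u ∷ encodeTerm t ∷ 0 ∷ c ∷ []) ≡ 0 →
      ∃[ c ] ⟦ equalAtE ⟧ (i ∷ encodeTerm t ∷ encodeTerm u ∷ 0 ∷ c ∷ []) ≡ 0 →
      ∃[ c ] quintuple isoCheck (pair e (pair i (pair (pair (encodeTerm t) (encodeTerm u)) (pair b c)))) ≡ 0
    combine b (c₁ , z₁) (c₂ , z₂) (c₃ , z₃) (c₄ , z₄) = c ,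
      ≡.trans (unpack (pair (encodeTerm t) (encodeTerm u)) b c)
      (≡.trans (isoCheck-pairs e i (encodeTerm t) (encodeTerm u) b c₁ c₂ c₃ c₄)
        (cong₂ _+_ (cong₂ _+_ (cong₂ _+_ z₁ z₂) z₃) z₄))
      where c = pair c₁ (pair c₂ (pair c₃ c₄))

  backward : (∃[ a ] ∀ b → ∃[ c ] quintuple isoCheck (pair e (pair i (pair a (pair b c)))) ≡ 0) → e ≅UF²₁ i
  backward (a , h) = inverse⇒≅
    ( sends⇒ e i (fst a) (λ b → _ , m+n≡0⇒m≡0 (part₁ b) (m+n≡0⇒m≡0 (part₁ b + part₂ b) (m+n≡0⇒m≡0 (part₁ b + part₂ b + part₃ b) (checked b))))
    , sends⇒ i e (snd a) (λ b → _ , m+n≡0⇒n≡0 (part₁ b) (m+n≡0⇒m≡0 (part₁ b + part₂ b) (m+n≡0⇒m≡0 (part₁ b + part₂ b + part₃ b) (checked b))))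
    -- The two inverse equations do not depend on `b`, so they are read off at `b = 0`.
    , equalAt⇒ e (snd a) (fst a) 0 _ (m+n≡0⇒n≡0 (part₁ 0 + part₂ 0) (m+n≡0⇒m≡0 (part₁ 0 + part₂ 0 + part₃ 0) (checked 0)))
    , equalAt⇒ i (fst a) (snd a) 0 _ (m+n≡0⇒n≡0 (part₁ 0 + part₂ 0 + part₃ 0) (checked 0)))
    where
    c : ℕ → ℕ
    c b = proj₁ (h b)
    checked : ∀ b → isoCheck e i a b (c b) ≡ 0
    checked b = ≡.trans (≡.sym (unpack a b (c b))) (proj₂ (h b))
    part₁ part₂ part₃ : ℕ → ℕ
    part₁ b = ⟦ sendsE ⟧ (e ∷ i ∷ fst a ∷ b ∷ fst (c b) ∷ [])
    part₂ b = ⟦ sendsE ⟧ (i ∷ e ∷ snd a ∷ b ∷ fst (snd (c b)) ∷ [])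
    part₃ b = ⟦ equalAtE ⟧ (e ∷ snd a ∷ fst a ∷ 0 ∷ fst (snd (snd (c b))) ∷ [])

≅-Σ⁰₃ : Σ⁰₃ _≅UF²₁_
≅-Σ⁰₃ = (λ n → quintuple isoCheck n ≡ 0) , zero-set-computable isoCheck-realised , iso⇔

-- Permutations of positions. A position is a pair (n , c) of a level and a column. Column 0
-- is the distinguished one; the others come in lines (κ , 0), (κ , 1), … indexed by keys
-- κ = (N , x , y). A key shifts, on each level n < N, the bi-infinite line
-- …, (bar κ , 1), (bar κ , 0), 0, (κ , 0), (κ , 1), … one step to the right.

source target : ℕ → ℕ
source κ = fst (snd κ)
target κ = snd (snd κ)

-- Exchanging source and target reverses the line, so `bar κ` is the key of the inverse permutation.
bar : ℕ → ℕ
bar κ = pair (fst κ) (pair (target κ) (source κ))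

shift : ℕ → ℕ → ℕ
shift κ c = ifz c (suc (pair κ 0))
  (ifeq (fst (pred c)) κ (suc (pair κ (suc (snd (pred c)))))
    (ifeq (fst (pred c)) (bar κ) (ifz (snd (pred c)) 0 (suc (pair (bar κ) (pred (snd (pred c)))))) c))

-- When source and target agree, `bar κ` is `κ` and the two half-lines coincide; such keys are made
-- to act as the identity.
act : ℕ → ℕ → ℕ
act κ p = ifz (fst κ ∸ fst p) p (ifeq (source κ) (target κ) p (pair (fst p) (shift κ (snd p))))

source-bar : ∀ κ → source (bar κ) ≡ target κ
source-bar κ = ≡.trans (cong fst (snd-pair (fst κ) (pair (target κ) (source κ)))) (fst-pair (target κ) (source κ))

target-bar : ∀ κ → target (bar κ) ≡ source κ
target-bar κ = ≡.trans (cong snd (snd-pair (fst κ) (pair (target κ) (source κ)))) (snd-pair (target κ) (source κ))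

level-bar : ∀ κ → fst (bar κ) ≡ fst κ
level-bar κ = fst-pair (fst κ) (pair (target κ) (source κ))

bar-involutive : ∀ κ → bar (bar κ) ≡ κ
bar-involutive κ = ≡.trans
  (cong₂ pair (level-bar κ) (≡.trans (cong₂ pair (target-bar κ) (source-bar κ)) (pair-unpair (snd κ))))
  (pair-unpair κ)

bar-moves : ∀ κ → source κ ≢ target κ → bar κ ≢ κ
bar-moves κ s≢t eq = s≢t (≡.trans (≡.sym (target-bar κ)) (cong target eq))

data Column (κ : ℕ) : ℕ → Set where
  star  : Column κ 0
  near  : ∀ s → Column κ (suc (pair κ s))
  far   : ∀ s → Column κ (suc (pair (bar κ) s))
  other : ∀ {q} → fst q ≢ κ → fst q ≢ bar κ → Column κ (suc q)

column : ∀ κ c → Column κ c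
column κ zero = star
column κ (suc q) with fst q ≟ κ | fst q ≟ bar κ
... | yes ≡.refl | _       = subst (λ q′ → Column κ (suc q′)) (pair-unpair q) (near (snd q))
... | no _       | yes eq  = subst (λ q′ → Column κ (suc q′))
                                   (≡.trans (cong (λ a → pair a (snd q)) (≡.sym eq)) (pair-unpair q)) (far (snd q))
... | no ≢κ      | no ≢bar = other ≢κ ≢bar

shift-near : ∀ κ s → shift κ (suc (pair κ s)) ≡ suc (pair κ (suc s))
shift-near κ s = ≡.trans (ifeq-≡ _ _ (fst-pair κ s)) (cong (λ m → suc (pair κ (suc m))) (snd-pair κ s))

shift-far : ∀ κ s → bar κ ≢ κ → shift κ (suc (pair (bar κ) s)) ≡ ifz s 0 (suc (pair (bar κ) (pred s)))
shift-far κ s b≢κ = ≡.trans (ifeq-≢ _ _ (λ eq → b≢κ (≡.trans (≡.sym (fst-pair (bar κ) s)) eq)))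
  (≡.trans (ifeq-≡ _ _ (fst-pair (bar κ) s)) (cong (λ m → ifz m 0 (suc (pair (bar κ) (pred m)))) (snd-pair (bar κ) s)))

shift-other : ∀ κ q → fst q ≢ κ → fst q ≢ bar κ → shift κ (suc q) ≡ suc q
shift-other κ q ≢κ ≢bar = ≡.trans (ifeq-≢ _ _ ≢κ) (ifeq-≢ _ _ ≢bar)

-- For `bar κ` the near and far half-lines exchange roles, so the two unit steps cancel.
shift-bar : ∀ κ c → bar κ ≢ κ → shift (bar κ) (shift κ c) ≡ c
shift-bar κ c b≢κ = go (column κ c)
  where
  b̄ : bar (bar κ) ≡ κ
  b̄ = bar-involutive κ
  b̄≢ : bar (bar κ) ≢ bar κ
  b̄≢ eq = b≢κ (≡.trans (≡.sym eq) b̄)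
  back : ∀ s → shift (bar κ) (suc (pair κ s)) ≡ ifz s 0 (suc (pair κ (pred s)))
  back s = subst (λ a → shift (bar κ) (suc (pair a s)) ≡ ifz s 0 (suc (pair a (pred s)))) b̄ (shift-far (bar κ) s b̄≢)
  go : ∀ {c} → Column κ c → shift (bar κ) (shift κ c) ≡ c
  go star          = back 0
  go (near s)      = ≡.trans (cong (shift (bar κ)) (shift-near κ s)) (back (suc s))
  go (far zero)    = cong (shift (bar κ)) (shift-far κ 0 b≢κ)
  go (far (suc s)) = ≡.trans (cong (shift (bar κ)) (shift-far κ (suc s) b≢κ)) (shift-near (bar κ) s)
  go (other {q} ≢κ ≢bar) = ≡.trans (cong (shift (bar κ)) (shift-other κ q ≢κ ≢bar))
    (shift-other (bar κ) q ≢bar (λ eq → ≢κ (≡.trans eq b̄)))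

act-fixed : ∀ κ p → fst κ ≤ fst p → act κ p ≡ p
act-fixed κ p N≤n = cong (λ m → ifz m p (ifeq (source κ) (target κ) p (pair (fst p) (shift κ (snd p))))) (m≤n⇒m∸n≡0 N≤n)

data Action (κ p : ℕ) : Set where
  fixed  : act κ p ≡ p → fst κ ≤ fst p ⊎ source κ ≡ target κ → Action κ p
  moved  : act κ p ≡ pair (fst p) (shift κ (snd p)) → fst p < fst κ → source κ ≢ target κ → Action κ p

action : ∀ κ p → Action κ p
action κ p with fst κ ≤? fst p
... | yes N≤n = fixed (act-fixed κ p N≤n) (inj₁ N≤n)
... | no N≰n with source κ ≟ target κ
...   | yes eq = fixed (ifz-fixed (fst κ ∸ fst p)) (inj₂ eq)
  where
  ifz-fixed : ∀ m → ifz m p (ifeq (source κ) (target κ) p (pair (fst p) (shift κ (snd p)))) ≡ p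
  ifz-fixed zero    = ≡.refl
  ifz-fixed (suc _) = ifeq-≡ _ _ eq
...   | no ≢ = moved (≡.trans (ifz-positive (fst κ ∸ fst p) (m<n⇒0<n∸m (≰⇒> N≰n))) (ifeq-≢ _ _ ≢)) (≰⇒> N≰n) ≢
  where
  ifz-positive : ∀ {a b} m → 0 < m → ifz m a b ≡ b
  ifz-positive (suc _) _ = ≡.refl

-- `κ` and `bar κ` share their level bound and agree on whether source equals target, and `act`
-- keeps the level, so the mixed cases are contradictory.
act-bar : ∀ κ p → act (bar κ) (act κ p) ≡ p
act-bar κ p with action κ p | action (bar κ) (act κ p)
... | fixed eq _       | fixed eq′ _       = ≡.trans eq′ eq
... | fixed eq (inj₁ N≤n) | moved _ n<N _  = ⊥-elim (<⇒≱ n<N (subst₂ _≤_ (≡.sym (level-bar κ)) (cong fst (≡.sym eq)) N≤n))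
... | fixed eq (inj₂ s≡t) | moved _ _ s≢t  = ⊥-elim (s≢t (≡.trans (source-bar κ) (≡.trans (≡.sym s≡t) (≡.sym (target-bar κ)))))
... | moved eq n<N s≢t | fixed _ (inj₁ N≤n) =
      ⊥-elim (<⇒≱ n<N (subst₂ _≤_ (level-bar κ) (≡.trans (cong fst eq) (fst-pair (fst p) _)) N≤n))
... | moved eq n<N s≢t | fixed _ (inj₂ eq′) =
      ⊥-elim (s≢t (≡.trans (≡.sym (target-bar κ)) (≡.trans (≡.sym eq′) (source-bar κ))))
... | moved eq n<N s≢t | moved eq′ _ _ = ≡.trans eq′
      (≡.trans (cong₂ (λ n c → pair n (shift (bar κ) c)) (≡.trans (cong fst eq) (fst-pair (fst p) (shift κ (snd p))))
                                                         (≡.trans (cong snd eq) (snd-pair (fst p) (shift κ (snd p)))))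
      (≡.trans (cong (pair (fst p)) (shift-bar κ (snd p) (bar-moves κ s≢t))) (pair-unpair p)))

bar-act : ∀ κ p → act κ (act (bar κ) p) ≡ p
bar-act κ p = subst (λ b → act b (act (bar κ) p) ≡ p) (bar-involutive κ) (act-bar (bar κ) p)

name : ℕ → ℕ → ℕ
name x c = ifz c x (source (fst (pred c)))

-- Far columns are named `target κ` and near ones `source κ`. Shifting the line by one moves the
-- boundary between the two names across column `0`, which amounts to renaming that column.
name-shift : ∀ κ c → bar κ ≢ κ → name (target κ) (shift κ c) ≡ name (source κ) c
name-shift κ c b≢κ = go (column κ c)
  where
  key : ∀ a s → source (fst (pair a s)) ≡ source a
  key a s = cong source (fst-pair a s)
  go : ∀ {c} → Column κ c → name (target κ) (shift κ c) ≡ name (source κ) c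
  go star     = key κ 0
  go (near s) = ≡.trans (cong (name (target κ)) (shift-near κ s)) (≡.trans (key κ (suc s)) (≡.sym (key κ s)))
  go (far zero) = ≡.trans (cong (name (target κ)) (shift-far κ 0 b≢κ))
    (≡.trans (≡.sym (source-bar κ)) (≡.sym (key (bar κ) 0)))
  go (far (suc s)) = ≡.trans (cong (name (target κ)) (shift-far κ (suc s) b≢κ))
    (≡.trans (key (bar κ) s) (≡.sym (key (bar κ) (suc s))))
  go (other {q} ≢κ ≢bar) = cong (name (target κ)) (shift-other κ q ≢κ ≢bar)

-- Operations coded by f and g, and the algebras presented

gs : ℕ → Term → Term
gs zero    t = t
gs (suc r) t = g (gs r t)

-- A run of `g`s closed by an `f` acts as one unary symbol indexed by the length of the run; first
-- component `0` marks permutations, `1` marks queries.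
op : ℕ → Term → Term
op κ t = f (gs (pair 0 κ) t)

query : ℕ → ℕ → Term → Term
query p v t = f (gs (pair 1 (pair p v)) t)

word : List ℕ → Term
word []      = x₀
word (κ ∷ w) = op κ (word w)

-- The outermost letter acts first, because a query stands outside the word it travels through.
trace : List ℕ → ℕ → ℕ
trace []      p = p
trace (κ ∷ w) p = trace w (act κ p)

gs-[] : ∀ r s t → gs r s [ t ] ≡ gs r (s [ t ])
gs-[] zero    s t = ≡.refl
gs-[] (suc r) s t = cong g (gs-[] r s t)

word-++ : ∀ w u → word w [ word u ] ≡ word (w List.++ u)
word-++ []      u = ≡.refl
word-++ (κ ∷ w) u = cong f (≡.trans (gs-[] _ (word w) (word u)) (cong (gs (pair 0 κ)) (word-++ w u)))

trace-++ : ∀ w u p → trace (w List.++ u) p ≡ trace u (trace w p)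
trace-++ []      u p = ≡.refl
trace-++ (κ ∷ w) u p = trace-++ w u (act κ p)

module Presentation (Label : ℕ → ℕ → ℕ → Set) where

  -- Only words are related, as the run of an operation applied to a term starting with `g` would
  -- merge with that term's own run.
  data Relator (x : ℕ) : Term → Term → Set where
    cancel : ∀ κ w → Relator x (op (bar κ) (op κ (word w))) (word w)
    label  : ∀ w p v → Label x (trace w p) v → Relator x (query p v (word w)) (word w)

  Presents : ℕ → ℕ → Set
  Presents e x = ∀ s t → W e (codePair s t) ⇔ Relator x s t

  -- Substituting the word of `κ` appends `κ` to every word, so `κ` acts last on a transported
  -- position, just where the labels of `x` must be matched with those of `y`.
  word-sends : ∀ {e i x y} → Presents e x → Presents i y → ∀ κ →
    (∀ p v → Label x p v → Label y (act κ p) v) → SendsRelations e i (word (κ ∷ []))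
  word-sends {e} {i} {x} {y} px py κ h s s′ r = go (Equivalence.to (px s s′) r)
    where
    relator : ∀ {s t} → Relator y s t → Cong i s t
    relator r = gen (Equivalence.from (py _ _) r)
    go : ∀ {s s′} → Relator x s s′ → Cong i (s [ word (κ ∷ []) ]) (s′ [ word (κ ∷ []) ])
    go (cancel κ′ w) = subst₂ (Cong i)
      (≡.sym (word-++ (bar κ′ ∷ κ′ ∷ w) (κ ∷ []))) (≡.sym (word-++ w (κ ∷ []))) (relator (cancel κ′ (w List.++ κ ∷ [])))
    go (label w p v l) = subst₂ (Cong i)
      (cong f (≡.sym (≡.trans (gs-[] _ (word w) _) (cong (gs _) (word-++ w (κ ∷ []))))))
      (≡.sym (word-++ w (κ ∷ [])))
      (relator (label (w List.++ κ ∷ []) p v (subst (λ p′ → Label y p′ v) (≡.sym (trace-++ w (κ ∷ []) p)) (h _ v l))))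

  word-inverse : ∀ {e x} → Presents e x → ∀ κ → Cong e (word (bar κ ∷ []) [ word (κ ∷ []) ]) x₀
  word-inverse px κ = trans (≡⇒Cong (word-++ (bar κ ∷ []) (κ ∷ []))) (gen (Equivalence.from (px _ _) (cancel κ [])))

  presentations-≅ : ∀ {e i x y} → Presents e x → Presents i y → ∀ κ →
    (∀ p v → Label x p v → Label y (act κ p) v) → (∀ p v → Label y p v → Label x (act (bar κ) p) v) →
    e ≅UF²₁ i
  presentations-≅ {e} px py κ h h′ = inverse⇒≅ {t = word (κ ∷ [])} {u = word (bar κ ∷ [])}
    ( word-sends px py κ h
    , word-sends py px (bar κ) h′
    -- The cancelling relators have the barred letter outside; with `κ` outside, it is read as
    -- `bar (bar κ)`.
    , subst (λ k → Cong e (word (k ∷ []) [ word (bar κ ∷ []) ]) x₀) (bar-involutive κ) (word-inverse px (bar κ))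
    , word-inverse py κ )

  -- An invariant of terms modulo the relators of y: the number of leading g's,
  -- the permutation of positions performed, and whether the outermost query, if any, succeeds.
  register : Term → ℕ
  register x₀    = 0
  register (f t) = 0
  register (g t) = suc (register t)

  perm : Term → ℕ → ℕ
  perm x₀    p = p
  perm (f t) p = perm t (ifz (fst (register t)) (act (snd (register t)) p) p)
  perm (g t) p = perm t p

  -- The default `0` has first component `0`, so a term whose outermost symbol is not `f` counts as
  -- settled.
  last-code : Term → ℕ
  last-code x₀    = 0
  last-code (f t) = register t
  last-code (g t) = 0

  Succeeds : ℕ → (ℕ → ℕ) → ℕ → Set
  Succeeds y σ c = fst c ≡ 0 ⊎ Label y (σ (fst (snd c))) (snd (snd c))

  Settled : ℕ → Term → Set
  Settled y t = Succeeds y (perm t) (last-code t)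

  record _≈[_]_ (s : Term) (y : ℕ) (t : Term) : Set where
    constructor similar
    field
      register≡ : register s ≡ register t
      perm≡     : ∀ p → perm s p ≡ perm t p
      settled⇔  : Settled y s ⇔ Settled y t
  open _≈[_]_

  Succeeds-cong : ∀ {y σ τ c d} → (∀ p → σ p ≡ τ p) → c ≡ d → Succeeds y σ c → Succeeds y τ d
  Succeeds-cong eq ≡.refl (inj₁ z) = inj₁ z
  Succeeds-cong {y} {c = c} eq ≡.refl (inj₂ l) = inj₂ (subst (λ p → Label y p (snd (snd c))) (eq _) l)

  f-similar : ∀ {y s t} → s ≈[ y ] t → f s ≈[ y ] f t
  f-similar {y} {s} {t} e = similar ≡.refl same
    (mk⇔ (Succeeds-cong same (register≡ e)) (Succeeds-cong (λ p → ≡.sym (same p)) (≡.sym (register≡ e))))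
    where
    same : ∀ p → perm (f s) p ≡ perm (f t) p
    same p rewrite register≡ e = perm≡ e _

  register-gs : ∀ r {t} → register t ≡ 0 → register (gs r t) ≡ r
  register-gs zero    z = z
  register-gs (suc r) z = cong suc (register-gs r z)

  perm-gs : ∀ r t p → perm (gs r t) p ≡ perm t p
  perm-gs zero    t p = ≡.refl
  perm-gs (suc r) t p = perm-gs r t p

  perm-op : ∀ κ t p → register t ≡ 0 → perm (op κ t) p ≡ perm t (act κ p)
  perm-op κ t p z rewrite register-gs (pair 0 κ) {t} z | fst-pair 0 κ | snd-pair 0 κ = perm-gs (pair 0 κ) t (act κ p)

  perm-query : ∀ p v t p′ → register t ≡ 0 → perm (query p v t) p′ ≡ perm t p′
  perm-query p v t p′ z rewrite register-gs (pair 1 (pair p v)) {t} z | fst-pair 1 (pair p v) = perm-gs (pair 1 (pair p v)) t p′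

  settled-op : ∀ y κ t → register t ≡ 0 → Settled y (op κ t)
  settled-op y κ t z = inj₁ (≡.trans (cong fst (register-gs (pair 0 κ) {t} z)) (fst-pair 0 κ))

  settled-query : ∀ y p v t → register t ≡ 0 → Settled y (query p v t) ⇔ Label y (perm t p) v
  settled-query y p v t z = mk⇔ to from
    where
    c = pair 1 (pair p v)
    code : last-code (query p v t) ≡ c
    code = register-gs c {t} z
    p≡ : fst (snd c) ≡ p
    p≡ = ≡.trans (cong fst (snd-pair 1 (pair p v))) (fst-pair p v)
    v≡ : snd (snd c) ≡ v
    v≡ = ≡.trans (cong snd (snd-pair 1 (pair p v))) (snd-pair p v)
    strip : Succeeds y (perm t) c → Label y (perm t p) v
    strip (inj₁ z′) with ≡.trans (≡.sym (fst-pair 1 (pair p v))) z′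
    ... | ()
    strip (inj₂ l) = subst₂ (λ p′ v′ → Label y (perm t p′) v′) p≡ v≡ l
    to : Settled y (query p v t) → Label y (perm t p) v
    to s = strip (Succeeds-cong (λ p′ → perm-query p v t p′ z) code s)
    from : Label y (perm t p) v → Settled y (query p v t)
    from l = Succeeds-cong (λ p′ → ≡.sym (perm-query p v t p′ z)) (≡.sym code)
      (inj₂ (subst₂ (λ p′ v′ → Label y (perm t p′) v′) (≡.sym p≡) (≡.sym v≡) l))

  register-word : ∀ w → register (word w) ≡ 0
  register-word []      = ≡.refl
  register-word (_ ∷ _) = ≡.refl

  perm-word : ∀ w p → perm (word w) p ≡ trace w p
  perm-word []      p = ≡.refl
  perm-word (κ ∷ w) p = ≡.trans (perm-op κ (word w) p (register-word w)) (perm-word w (act κ p))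

  settled-word : ∀ y w → Settled y (word w)
  settled-word y []      = inj₁ ≡.refl
  settled-word y (κ ∷ w) = settled-op y κ (word w) (register-word w)

  relator-similar : ∀ {y s t} → Relator y s t → s ≈[ y ] t
  relator-similar {y} (cancel κ w) = similar (≡.sym (register-word w))
    (λ p → ≡.trans (perm-op (bar κ) (op κ (word w)) p ≡.refl)
      (≡.trans (perm-op κ (word w) (act (bar κ) p) (register-word w)) (cong (perm (word w)) (bar-act κ p))))
    (mk⇔ (λ _ → settled-word y w) (λ _ → settled-op y (bar κ) (op κ (word w)) ≡.refl))
  relator-similar {y} (label w p v l) = similar (≡.sym (register-word w))
    (λ p′ → perm-query p v (word w) p′ (register-word w))
    (mk⇔ (λ _ → settled-word y w) (λ _ → Equivalence.from (settled-query y p v (word w) (register-word w))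
      (subst (λ p′ → Label y p′ v) (≡.sym (perm-word w p)) l)))

  -- Similarity is a congruence containing the relators, hence the invariant is well defined on the
  -- presented algebra.
  Cong-similar : ∀ {i y} → Presents i y → ∀ {s t} → Cong i s t → s ≈[ y ] t
  Cong-similar py (gen r)     = relator-similar (Equivalence.to (py _ _) r)
  Cong-similar py refl        = similar ≡.refl (λ _ → ≡.refl) (mk⇔ (λ x → x) (λ x → x))
  Cong-similar py (sym c)     = let e = Cong-similar py c in
    similar (≡.sym (register≡ e)) (λ p → ≡.sym (perm≡ e p)) (mk⇔ (Equivalence.from (settled⇔ e)) (Equivalence.to (settled⇔ e)))
  Cong-similar py (trans c d) = let e = Cong-similar py c ; e′ = Cong-similar py d in
    similar (≡.trans (register≡ e) (register≡ e′)) (λ p → ≡.trans (perm≡ e p) (perm≡ e′ p))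
      (mk⇔ (λ s → Equivalence.to (settled⇔ e′) (Equivalence.to (settled⇔ e) s))
           (λ s → Equivalence.from (settled⇔ e) (Equivalence.from (settled⇔ e′) s)))
  Cong-similar py (f-cong c)  = f-similar (Cong-similar py c)
  Cong-similar py (g-cong c)  = let e = Cong-similar py c in
    similar (cong suc (register≡ e)) (perm≡ e) (mk⇔ (λ _ → inj₁ ≡.refl) (λ _ → inj₁ ≡.refl))

  -- A term contains finitely many keys, each fixing all levels from its first component on; the sum
  -- of these bounds works for all.
  perm-eventually-fixed : ∀ t → ∃[ N ] ∀ p → N ≤ fst p → perm t p ≡ p
  perm-eventually-fixed x₀    = 0 , λ _ _ → ≡.refl
  perm-eventually-fixed (g t) = perm-eventually-fixed t
  perm-eventually-fixed (f t) with perm-eventually-fixed t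
  ... | N , h = N + fst (snd (register t)) , fixes
    where
    κ = snd (register t)
    step : ∀ r p → fst κ ≤ fst p → ifz r (act κ p) p ≡ p
    step zero    p κ≤ = act-fixed κ p κ≤
    step (suc _) p _  = ≡.refl
    fixes : ∀ p → N + fst κ ≤ fst p → perm (f t) p ≡ p
    fixes p le = ≡.trans (cong (perm t) (step (fst (register t)) p (≤-trans (m≤n+m (fst κ) N) le)))
      (h p (≤-trans (m≤m+n N (fst κ)) le))

  -- The relator `query p v x₀ = x₀` becomes `query p v t = t`. As `t` is settled, so is the query,
  -- hence `y` has the label `v` at `perm t p`, which is `p` at high levels.
  hom-preserves-labels : ∀ {e i x y t} → Presents e x → Presents i y → SendsRelations e i t →
    ∃[ N ] ∀ p v → N ≤ fst p → Label x p v → Label y p v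
  hom-preserves-labels {e} {i} {x} {y} {t} px py h = N , λ p v N≤ l →
    subst (λ p′ → Label y p′ v) (fixes p N≤) (Equivalence.to (settled-query y p v t (register-zero p v l))
      (Equivalence.from (settled⇔ (queried p v l)) settled))
    where
    N = proj₁ (perm-eventually-fixed t)
    fixes = proj₂ (perm-eventually-fixed t)
    queried : ∀ p v → Label x p v → query p v t ≈[ y ] t
    queried p v l = Cong-similar py
      (subst (λ s → Cong i (f s) t) (gs-[] _ x₀ t) (h _ _ (Equivalence.from (px _ _) (label [] p v l))))
    register-zero : ∀ p v → Label x p v → register t ≡ 0
    register-zero p v l = ≡.sym (register≡ (queried p v l))
    -- The image of a cancelling relator makes `t` similar to a term whose outermost operation is a
    -- permutation; thus `t` is not a failing query.
    doubled : op (bar 0) (op 0 t) ≈[ y ] t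
    doubled = Cong-similar py (subst (λ s → Cong i (f s) t)
      (≡.trans (gs-[] _ (op 0 x₀) t) (cong (λ s → gs (pair 0 (bar 0)) (f s)) (gs-[] _ x₀ t)))
      (h _ _ (Equivalence.from (px _ _) (cancel 0 []))))
    settled : Settled y t
    settled = Equivalence.to (settled⇔ doubled) (settled-op y (bar 0) (op 0 t) ≡.refl)

-- Uniformly computably enumerable families

-- `ev-Mu` demands positive values below the result, so an arbitrary zero is replaced by the least
-- one.
least-zero : ∀ (F : ℕ → ℕ) c → F c ≡ 0 → ∃[ m ] F m ≡ 0 × (∀ j → j < m → ∃[ k ] F j ≡ suc k)
least-zero F zero    z = 0 , z , λ _ ()
least-zero F (suc c) z with F 0 in eq
... | zero  = 0 , eq , λ _ ()
... | suc k with least-zero (λ m → F (suc m)) c z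
...   | m , zm , h = suc m , zm , λ { zero _ → k , eq ; (suc j) (s≤s j<m) → h j j<m }

-- The s-m-n construction.
specialise : Prog → ℕ → Prog
specialise p x = Comp p (PairF (constP x) I)

specialise-computable : ∀ p → Computable (λ x → encodeProg (specialise p x))
specialise-computable p = encodeProg q , λ x → q , ≡.refl , subst (Eval q x) (index x) (h x)
  where
  -- The numerals come from the Gödel numbering: `1` and `2` code `S` and `I`, while offsets `5` and
  -- `6` belong to `Comp` and `PairF`.
  const-index : ∀ x → natrec 0 (λ _ c → 5 + 4 * pair 1 c) x ≡ encodeProg (constP x)
  const-index zero    = ≡.refl
  const-index (suc x) = cong (λ c → 5 + 4 * pair 1 c) (const-index x)
  r = realise-unary {F = λ ρ → _} (realise
    (5 plus fourfold (pairE (lit (encodeProg p))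
      (6 plus fourfold (pairE (recE (lit 0) (5 plus fourfold (pairE (lit 1) (var (# 1)))) (var (# 0))) (lit 2))))))
  q = proj₁ r
  h = proj₂ r
  index : ∀ x → 5 + 4 * pair (encodeProg p) (6 + 4 * pair (natrec 0 (λ _ c → 5 + 4 * pair 1 c) x) 2)
              ≡ encodeProg (specialise p x)
  index x = cong (λ c → 5 + 4 * pair (encodeProg p) (6 + 4 * pair c 2)) (const-index x)

specialise-Mu-halts : ∀ p (F : ℕ → ℕ → ℕ → ℕ) → (∀ x n c → Eval p (pair (pair x n) c) (F x n c)) →
  ∀ x n → W (encodeProg (specialise (Mu p) x)) n ⇔ (∃[ c ] F x n c ≡ 0)
specialise-Mu-halts p F eval x n = mk⇔ to from
  where
  input : Eval (PairF (constP x) I) n (pair x n)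
  input = ev-PairF {a = x} (ev-const x n) (ev-I n)
  halts : ∀ {m y} → m ≡ pair x n → Eval (Mu p) m y → F x n y ≡ 0
  halts {y = y} ≡.refl e = Eval-deterministic (eval x n y) (proj₁ (Mu-inv e))
  run : ∀ {y} → Eval (specialise (Mu p) x) n y → F x n y ≡ 0
  run (ev-Comp d e) = halts (Eval-deterministic d input) e
  to : W (encodeProg (specialise (Mu p) x)) n → ∃[ c ] F x n c ≡ 0
  to (y , p′ , eq , d) = y , run (subst (λ q → Eval q n y) (encodeProg-injective p′ (specialise (Mu p) x) eq) d)
  from : ∃[ c ] F x n c ≡ 0 → W (encodeProg (specialise (Mu p) x)) n
  from (c , z) = let (m , zm , below) = least-zero (F x n) c z in
    m , specialise (Mu p) x , ≡.refl , ev-Comp input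
      (ev-Mu (subst (Eval p (pair (pair x n) m)) zm (eval x n m))
        (λ j j<m → proj₁ (below j j<m) , subst (Eval p (pair (pair x n) j)) (proj₂ (below j j<m)) (eval x n j)))

-- `h x` is an index of the program that on input `n` searches for a zero `c`.
uniformly-ce : ∀ {F : Vec ℕ 3 → ℕ} → Realised F →
  Σ (ℕ → ℕ) λ h → Computable h × (∀ x n → W (h x) n ⇔ (∃[ c ] F (x ∷ n ∷ c ∷ []) ≡ 0))
uniformly-ce {F} r = go (realise-unary (realise (call F r (fstE (fstE in₁) ∷ sndE (fstE in₁) ∷ sndE in₁ ∷ []))))
  where
  in₁ : Exp 1
  in₁ = var (# 0)
  value : ∀ x n c → F (fst (fst (pair (pair x n) c)) ∷ snd (fst (pair (pair x n) c)) ∷ snd (pair (pair x n) c) ∷ [])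
                    ≡ F (x ∷ n ∷ c ∷ [])
  value x n c = ≡.trans
    (cong₂ (λ a c → F (fst a ∷ snd a ∷ c ∷ [])) (fst-pair (pair x n) c) (snd-pair (pair x n) c))
    (cong₂ (λ x n → F (x ∷ n ∷ c ∷ [])) (fst-pair x n) (snd-pair x n))
  go : (∃[ p ] ∀ m → Eval p m (F (fst (fst m) ∷ snd (fst m) ∷ snd m ∷ []))) →
       Σ (ℕ → ℕ) λ h → Computable h × (∀ x n → W (h x) n ⇔ (∃[ c ] F (x ∷ n ∷ c ∷ []) ≡ 0))
  go (p , h) = (λ x → encodeProg (specialise (Mu p) x)) , specialise-computable (Mu p) ,
    specialise-Mu-halts p (λ x n c → F (x ∷ n ∷ c ∷ []))
      (λ x n c → subst (Eval p (pair (pair x n) c)) (value x n c) (h (pair (pair x n) c)))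

characteristic : ∀ {R} → ComputablePred R → Σ (ℕ → ℕ) λ T → Realised (on₁ T) × (∀ n → R n ⇔ (T n ≡ 0))
characteristic {R} (r , total , spec) with encodeProg-surjective r
... | p , ≡.refl = T , (Comp p Fst , λ { (n ∷ []) → ev-Comp (ev-fst-pair n 0) (eval n) }) , λ n → mk⇔
  (λ Rn → unique n 0 (Equivalence.to (spec n) Rn))
  (λ z → Equivalence.from (spec n) (p , ≡.refl , subst (Eval p n) z (eval n)))
  where
  T : ℕ → ℕ
  T n = proj₁ (total n)
  eval : ∀ n → Eval p n (T n)
  eval n with total n
  ... | y , p′ , eq , d with encodeProg-injective p′ p eq
  ...   | ≡.refl = d
  unique : ∀ n y → Φ (encodeProg p) n y → T n ≡ y
  unique n y (p′ , eq , d) with encodeProg-injective p′ p eq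
  ... | ≡.refl = Eval-deterministic (eval n) d

-- Computability of the permutations, names and term codes.

bar-realised : Realised (on₁ bar)
bar-realised = realise-ext (λ { (κ ∷ []) → ≡.refl }) (realise (pairE (fstE k) (pairE (sndE (sndE k)) (fstE (sndE k)))))
  where k = var {1} (# 0)

barE : ∀ {n} → Exp n → Exp n
barE κ = call (on₁ bar) bar-realised (κ ∷ [])

shift-realised : Realised (on₂ shift)
shift-realised = realise-ext (λ { (κ ∷ c ∷ []) → ≡.refl }) (realise
  (ifzE c (sucE (pairE κ (lit 0)))
    (ifeqE (fstE (predE c)) κ (sucE (pairE κ (sucE (sndE (predE c)))))
      (ifeqE (fstE (predE c)) (barE κ)
        (ifzE (sndE (predE c)) (lit 0) (sucE (pairE (barE κ) (predE (sndE (predE c)))))) c))))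
  where
  κ c : Exp 2
  κ = var (# 0)
  c = var (# 1)

act-realised : Realised (on₂ act)
act-realised = realise-ext (λ { (κ ∷ p ∷ []) → ≡.refl }) (realise
  (ifzE (fstE κ ∸E fstE p) p (ifeqE (fstE (sndE κ)) (sndE (sndE κ)) p
    (pairE (fstE p) (call (on₂ shift) shift-realised (κ ∷ sndE p ∷ []))))))
  where
  κ p : Exp 2
  κ = var (# 0)
  p = var (# 1)

actE : ∀ {n} → Exp n → Exp n → Exp n
actE κ p = call (on₂ act) act-realised (κ ∷ p ∷ [])

nameE : ∀ {n} → Exp n → Exp n → Exp n
nameE x c = ifzE c x (fstE (sndE (fstE (predE c))))

runCode : ℕ → ℕ → ℕ
runCode r m = 1 + 2 * natrec m (λ _ k → 2 + 2 * k) r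

runCode-realised : Realised (on₂ runCode)
runCode-realised = realise-ext (λ { (r ∷ m ∷ []) → ≡.refl }) (realise
  (1 plus double (recE (var (# 1)) (2 plus double (var (# 1))) (var (# 0)))))

runE : ∀ {n} → Exp n → Exp n → Exp n
runE r m = call (on₂ runCode) runCode-realised (r ∷ m ∷ [])

encode-run : ∀ r t → encodeTerm (f (gs r t)) ≡ runCode r (encodeTerm t)
encode-run r t = cong (λ m → 1 + 2 * m) (go r)
  where
  go : ∀ r → encodeTerm (gs r t) ≡ natrec (encodeTerm t) (λ _ k → 2 + 2 * k) r
  go zero    = ≡.refl
  go (suc r) = cong (λ m → 2 + 2 * m) (go r)

-- The approximations of a Σ⁰₃ equivalence relation

module Approximation (T : ℕ → ℕ) (T-realised : Realised (on₁ T)) where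

  -- A candidate z codes two numbers together with an outermost witness of their equivalence.
  left right : ℕ → ℕ
  left z  = fst z
  right z = fst (snd z)

  instance-code : ℕ → ℕ → ℕ → ℕ
  instance-code z b c = pair (left z) (pair (right z) (pair (snd (snd z)) (pair b c)))

  Verified : ℕ → ℕ → Set
  Verified z k = ∀ b → b < k → ∃[ c ] T (instance-code z b c) ≡ 0

  -- The relation ~ₙₖ.
  data Conn (n k : ℕ) : ℕ → ℕ → Set where
    here     : ∀ {i} → Conn n k i i
    forward  : ∀ {i} z → Conn n k i (left z) → z < n → Verified z k → Conn n k i (right z)
    backward : ∀ {i} z → Conn n k i (right z) → z < n → Verified z k → Conn n k i (left z)

  Conn-trans : ∀ {n k i j l} → Conn n k i j → Conn n k j l → Conn n k i l
  Conn-trans c here               = c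
  Conn-trans c (forward z d z< v) = forward z (Conn-trans c d) z< v
  Conn-trans c (backward z d z< v) = backward z (Conn-trans c d) z< v

  Conn-sym : ∀ {n k i j} → Conn n k i j → Conn n k j i
  Conn-sym here                = here
  Conn-sym (forward z c z< v)  = Conn-trans (backward z here z< v) (Conn-sym c)
  Conn-sym (backward z c z< v) = Conn-trans (forward z here z< v) (Conn-sym c)

  -- The query with p = (n , c) and v = (j , k) asks whether name(c) ~ₙₖ j.
  Label : ℕ → ℕ → ℕ → Set
  Label x p v = Conn (fst p) (snd v) (name x (snd p)) (fst v)

  open Presentation Label public

  -- Below level `fst κ` a proper shift carries names along. From that level on nothing moves, and
  -- the changed name of column `0` is absorbed by the assumed connection of target and source.
  act-label : ∀ κ → (∀ n k → fst κ ≤ n → Conn n k (target κ) (source κ)) →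
              ∀ p v → Label (source κ) p v → Label (target κ) (act κ p) v
  act-label κ h p v l with action κ p
  ... | fixed eq (inj₁ N≤n) = subst (λ q → Label (target κ) q v) (≡.sym eq) (relabel (snd p) l)
    where
    relabel : ∀ c → Conn (fst p) (snd v) (name (source κ) c) (fst v) → Conn (fst p) (snd v) (name (target κ) c) (fst v)
    relabel zero    = Conn-trans (h _ _ N≤n)
    relabel (suc c) = λ l → l
  ... | fixed eq (inj₂ s≡t) = subst₂ (λ x q → Label x q v) s≡t (≡.sym eq) l
  ... | moved eq _ s≢t = subst (λ q → Label (target κ) q v) (≡.sym eq)
    (subst₂ (λ n c → Conn n (snd v) (name (target κ) c) (fst v))
      (≡.sym (fst-pair (fst p) (shift κ (snd p)))) (≡.sym (snd-pair (fst p) (shift κ (snd p))))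
      (subst (λ i → Conn (fst p) (snd v) i (fst v)) (≡.sym (name-shift κ (snd p) (bar-moves κ s≢t))) l))

  private
    pattern VerifiedUpTo z k    = 1 ∷ z ∷ k ∷ 0 ∷ 0 ∷ []
    pattern Connected n k i j   = 2 ∷ n ∷ k ∷ i ∷ j ∷ []
    pattern Labelled w p v      = 3 ∷ w ∷ p ∷ v ∷ 0 ∷ []
    pattern Related s t         = 4 ∷ s ∷ t ∷ 0 ∷ 0 ∷ []

  instanceE : Exp 16 → Exp 16 → Exp 16 → Exp 16
  instanceE z b c = pairE (fstE z) (pairE (fstE (sndE z)) (pairE (sndE (sndE z)) (pairE b c)))

  rules : Vec Rule 9
  rules =
      ([] ⊢ ⟨ lit 1 , h₁ , lit 0 , lit 0 , lit 0 ⟩)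
    ∷ (((p₀ , lit 1) ∷ (call (on₁ T) T-realised (instanceE p₁ p₂ h₁ ∷ []) , lit 0) ∷ []) ⊢
       ⟨ lit 1 , p₁ , sucE p₂ , lit 0 , lit 0 ⟩)
    ∷ ([] ⊢ ⟨ lit 2 , h₁ , h₂ , h₃ , h₃ ⟩)
    -- Guards are equations, so `z < n` is expressed by a vanishing truncated difference.
    ∷ (((p₀ , lit 2) ∷ (q₀ , lit 1) ∷ (q₂ , p₂) ∷ (sucE q₁ ∸E p₁ , lit 0) ∷ (p₄ , fstE q₁) ∷ []) ⊢
       ⟨ lit 2 , p₁ , p₂ , p₃ , fstE (sndE q₁) ⟩)
    ∷ (((p₀ , lit 2) ∷ (q₀ , lit 1) ∷ (q₂ , p₂) ∷ (sucE q₁ ∸E p₁ , lit 0) ∷ (p₄ , fstE (sndE q₁)) ∷ []) ⊢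
       ⟨ lit 2 , p₁ , p₂ , p₃ , fstE q₁ ⟩)
    ∷ (((p₀ , lit 2) ∷ (nameE param h₁ , p₃) ∷ []) ⊢
       ⟨ lit 3 , lit 0 , pairE p₁ h₁ , pairE p₄ p₂ , lit 0 ⟩)
    -- Words grow outwards, so the starting position is pulled back along the new letter, keeping
    -- its trace.
    ∷ (((p₀ , lit 3) ∷ []) ⊢ ⟨ lit 3 , runE (pairE (lit 0) h₁) p₁ , actE (barE h₁) p₂ , p₃ , lit 0 ⟩)
    -- The premise serves as a certificate that `p₁` codes a word.
    ∷ (((p₀ , lit 3) ∷ []) ⊢
       ⟨ lit 4 , runE (pairE (lit 0) (barE h₁)) (runE (pairE (lit 0) h₁) p₁) , p₁ , lit 0 , lit 0 ⟩)
    ∷ (((p₀ , lit 3) ∷ []) ⊢ ⟨ lit 4 , runE (pairE (lit 1) (pairE p₂ p₃)) p₁ , p₁ , lit 0 , lit 0 ⟩)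
    ∷ []

  module P = Enumeration rules

  Valid : ℕ → Fact → Set
  Valid x (1 ∷ z ∷ k ∷ _)         = Verified z k
  Valid x (2 ∷ n ∷ k ∷ i ∷ j ∷ []) = Conn n k i j
  Valid x (3 ∷ m ∷ p ∷ v ∷ _)     = ∃[ w ] encodeTerm (word w) ≡ m × Label x (trace w p) v
  Valid x (4 ∷ a ∷ b ∷ _)         = ∃[ s ] ∃[ t ] encodeTerm s ≡ a × encodeTerm t ≡ b × Relator x s t
  Valid x _                       = ⊤

  Valid-step : ∀ x h p q → All (λ r → Holds (guards r) (Context x h p q) → Valid x p → Valid x q →
                                       Valid x (⟦ conclusion r ⟧* (Context x h p q))) rules
  Valid-step x (_ ∷ h₁ ∷ h₂ ∷ h₃ ∷ h₄ ∷ []) (p₀ ∷ p₁ ∷ p₂ ∷ p₃ ∷ p₄ ∷ []) (q₀ ∷ q₁ ∷ q₂ ∷ q₃ ∷ q₄ ∷ []) =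
      (λ _ _ _ _ ())
    ∷ (λ { (≡.refl , z , _) verified _ b b< → extend {p₁} {p₂} {h₁} verified z (m≤n⇒m<n∨m≡n (≤-pred b<)) })
    ∷ (λ _ _ _ → here)
    ∷ (λ { (≡.refl , ≡.refl , ≡.refl , z< , ≡.refl , _) c v → forward q₁ c (m∸n≡0⇒m≤n z<) v })
    ∷ (λ { (≡.refl , ≡.refl , ≡.refl , z< , ≡.refl , _) c v → backward q₁ c (m∸n≡0⇒m≤n z<) v })
    ∷ (λ { (≡.refl , ≡.refl , _) c _ → [] , ≡.refl , initial c })
    ∷ (λ { (≡.refl , _) (w , ≡.refl , l) _ → h₁ ∷ w , encode-run (pair 0 h₁) (word w) ,
           subst (λ p → Label x (trace w p) p₃) (≡.sym (bar-act h₁ p₂)) l })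
    ∷ (λ { (≡.refl , _) (w , ≡.refl , _) _ → op (bar h₁) (op h₁ (word w)) , word w ,
           ≡.trans (encode-run (pair 0 (bar h₁)) (op h₁ (word w)))
                   (cong (runCode (pair 0 (bar h₁))) (encode-run (pair 0 h₁) (word w))) ,
           ≡.refl , cancel h₁ w })
    ∷ (λ { (≡.refl , _) (w , ≡.refl , l) _ → query p₂ p₃ (word w) , word w ,
           encode-run (pair 1 (pair p₂ p₃)) (word w) , ≡.refl , label w p₂ p₃ l })
    ∷ []
    where
    extend : ∀ {z k c b} → Verified z k → T (instance-code z k c) ≡ 0 → b < k ⊎ b ≡ k →
             ∃[ c ] T (instance-code z b c) ≡ 0
    extend verified t (inj₁ b<k)    = verified _ b<k
    extend verified t (inj₂ ≡.refl) = _ , t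
    initial : ∀ {n k j c} → Conn n k (name x c) j → Label x (pair n c) (pair j k)
    initial {n} {k} {j} {c} h = subst₂ (λ n c → Conn n (snd (pair j k)) (name x c) (fst (pair j k)))
      (≡.sym (fst-pair n c)) (≡.sym (snd-pair n c))
      (subst₂ (λ j k → Conn n k (name x c) j) (≡.sym (fst-pair j k)) (≡.sym (snd-pair j k)) h)

  Valid-sound : ∀ {x φ} → P.Derivable x φ → Valid x φ
  Valid-sound {x} (n P., ≡.refl) = P.fact-sound x (Valid x) tt (Valid-step x) n

  Verified-derivable : ∀ x z k → Verified z k → P.Derivable x (VerifiedUpTo z k)
  Verified-derivable x z zero    v = P.fact-complete₀ x (# 0) z 0 0 0 tt
  Verified-derivable x z (suc k) v = P.fact-complete₁ x (# 1) (proj₁ (v k ≤-refl)) 0 0 0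
    (Verified-derivable x z k (λ b b<k → v b (m≤n⇒m≤1+n b<k))) (≡.refl , proj₂ (v k ≤-refl) , tt)

  Conn-derivable : ∀ x {n k i j} → Conn n k i j → P.Derivable x (Connected n k i j)
  Conn-derivable x (here {i}) = P.fact-complete₀ x (# 2) _ _ i 0 tt
  Conn-derivable x (forward z c z<n v) = P.fact-complete x (# 3) 0 0 0 0
    (Conn-derivable x c) (Verified-derivable x z _ v) (≡.refl , ≡.refl , ≡.refl , m≤n⇒m∸n≡0 z<n , ≡.refl , tt)
  Conn-derivable x (backward z c z<n v) = P.fact-complete x (# 4) 0 0 0 0
    (Conn-derivable x c) (Verified-derivable x z _ v) (≡.refl , ≡.refl , ≡.refl , m≤n⇒m∸n≡0 z<n , ≡.refl , tt)

  Label-derivable : ∀ x w p v → Label x (trace w p) v → P.Derivable x (Labelled (encodeTerm (word w)) p v)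
  Label-derivable x [] p v l = subst₂ (λ p v → P.Derivable x (Labelled 0 p v)) (pair-unpair p) (pair-unpair v)
    (P.fact-complete₁ x (# 5) (snd p) 0 0 0 (Conn-derivable x l) (≡.refl , ≡.refl , tt))
  Label-derivable x (κ ∷ w) p v l = subst₂ (λ m p → P.Derivable x (Labelled m p v))
    (≡.sym (encode-run (pair 0 κ) (word w))) (act-bar κ p)
    (P.fact-complete₁ x (# 6) κ 0 0 0 (Label-derivable x w (act κ p) v l) (≡.refl , tt))

  -- By reflexivity each word occurs in some `Labelled` fact, so the cancellation rule reaches all
  -- words.
  some-label : ∀ x q → ∃[ v ] Label x q v
  some-label x q = pair i 0 , subst (Conn (fst q) (snd (pair i 0)) i) (≡.sym (fst-pair i 0)) here
    where i = name x (snd q)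

  Relator-derivable : ∀ {x s t} → Relator x s t → P.Derivable x (Related (encodeTerm s) (encodeTerm t))
  Relator-derivable {x} (cancel κ w) = subst (λ m → P.Derivable x (Related m (encodeTerm (word w))))
    (≡.sym (≡.trans (encode-run (pair 0 (bar κ)) (op κ (word w)))
                    (cong (runCode (pair 0 (bar κ))) (encode-run (pair 0 κ) (word w)))))
    (P.fact-complete₁ x (# 7) κ 0 0 0
      (Label-derivable x w 0 (proj₁ (some-label x (trace w 0))) (proj₂ (some-label x (trace w 0)))) (≡.refl , tt))
  Relator-derivable {x} (label w p v l) = subst (λ m → P.Derivable x (Related m (encodeTerm (word w))))
    (≡.sym (encode-run (pair 1 (pair p v)) (word w)))
    (P.fact-complete₁ x (# 8) 0 0 0 0 (Label-derivable x w p v l) (≡.refl , tt))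

  enumerated wanted : Vec (Exp 3) 5
  enumerated = P.factE (var (# 0)) (var (# 2))
  wanted     = lit 4 ∷ fstE (var (# 1)) ∷ sndE (var (# 1)) ∷ lit 0 ∷ lit 0 ∷ []

  presentations : Σ (ℕ → ℕ) λ h → Computable h × (∀ x → Presents (h x) x)
  presentations = proj₁ u , proj₁ (proj₂ u) , λ x s t → mk⇔
    (λ w → to x s t (Equivalence.to (proj₂ (proj₂ u) x (codePair s t)) w))
    (λ r → Equivalence.from (proj₂ (proj₂ u) x (codePair s t)) (from x s t (Relator-derivable r)))
    where
    u = uniformly-ce (realise (differE enumerated wanted))
    ρ : ℕ → Term → Term → ℕ → Vec ℕ 3
    ρ x s t c = x ∷ codePair s t ∷ c ∷ []
    wanted≡ : ∀ s t → Related (fst (codePair s t)) (snd (codePair s t)) ≡ Related (encodeTerm s) (encodeTerm t)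
    wanted≡ s t = cong₂ (λ a b → 4 ∷ a ∷ b ∷ 0 ∷ 0 ∷ [])
      (fst-pair (encodeTerm s) (encodeTerm t)) (snd-pair (encodeTerm s) (encodeTerm t))
    encodeTerm-injective : ∀ {s t} → encodeTerm s ≡ encodeTerm t → s ≡ t
    encodeTerm-injective {s} {t} eq =
      ≡.trans (≡.sym (decode-encodeTerm s)) (≡.trans (cong decodeTerm eq) (decode-encodeTerm t))
    unique : ∀ x s t → Valid x (Related (encodeTerm s) (encodeTerm t)) → Relator x s t
    unique x s t (s′ , t′ , eqs , eqt , r) = subst₂ (Relator x) (encodeTerm-injective eqs) (encodeTerm-injective eqt) r
    to : ∀ x s t → ∃[ c ] ⟦ differE enumerated wanted ⟧ (ρ x s t c) ≡ 0 → Relator x s t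
    to x s t (c , z) = unique x s t
      (Valid-sound (c P., ≡.trans (differ≡0⇒ enumerated wanted (ρ x s t c) z) (wanted≡ s t)))
    from : ∀ x s t → P.Derivable x (Related (encodeTerm s) (encodeTerm t)) →
           ∃[ c ] ⟦ differE enumerated wanted ⟧ (ρ x s t c) ≡ 0
    from x s t (c P., eq) = c , differ≡0 enumerated wanted (ρ x s t c) (≡.trans eq (≡.sym (wanted≡ s t)))

  -- Correctness of the reduction.

  module _ (em : ExcludedMiddle 0ℓ) {E : Rel ℕ 0ℓ} (E-equiv : IsEquivalence E)
           (E⇔ : ∀ x y → E x y ⇔ (∃[ a ] ∀ b → ∃[ c ] T (pair x (pair y (pair a (pair b c)))) ≡ 0)) where

    private module E = IsEquivalence E-equiv

    instance-pair : ∀ x y a b c → instance-code (pair x (pair y a)) b c ≡ pair x (pair y (pair a (pair b c)))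
    instance-pair x y a b c = cong₂ (λ i m → pair i (pair (fst m) (pair (snd m) (pair b c)))) (fst-pair x (pair y a)) (snd-pair x (pair y a))
      ⟨≡⟩ cong₂ (λ j a → pair x (pair j (pair a (pair b c)))) (fst-pair y a) (snd-pair y a)
      where
      _⟨≡⟩_ : ∀ {i j k : ℕ} → i ≡ j → j ≡ k → i ≡ k
      _⟨≡⟩_ = ≡.trans

    -- A genuine outermost witness gives a candidate `z` that passes every check and is available
    -- from level `suc z` on.
    E⇒Conn : ∀ {x y} → E x y → ∃[ N ] ∀ n k → N ≤ n → Conn n k x y
    E⇒Conn {x} {y} e with Equivalence.to (E⇔ x y) e
    ... | a , h = suc z , λ n k z<n → subst₂ (Conn n k) left≡ right≡
      (forward z here z<n (λ b _ → proj₁ (h b) , ≡.trans (cong T (instance-pair x y a b (proj₁ (h b)))) (proj₂ (h b))))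
      where
      z = pair x (pair y a)
      left≡ : left z ≡ x
      left≡ = fst-pair x (pair y a)
      right≡ : right z ≡ y
      right≡ = ≡.trans (cong fst (snd-pair x (pair y a))) (fst-pair y a)

    Correct : ℕ → Set
    Correct z = ∀ b → ∃[ c ] T (instance-code z b c) ≡ 0

    correct⇒E : ∀ z → Correct z → E (left z) (right z)
    correct⇒E z h = Equivalence.from (E⇔ (left z) (right z)) (snd (snd z) , h)

    -- Excluded middle decides for each candidate below `n` whether some `b` refutes it; `K` is
    -- raised beyond one such `b` for every incorrect candidate.
    threshold : ∀ n → ∃[ K ] ∀ z → z < n → Verified z K → Correct z
    threshold zero    = 0 , λ _ ()
    threshold (suc n) with threshold n | em {∃[ b ] ¬ (∃[ c ] T (instance-code n b c) ≡ 0)}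
    ... | K , h | yes (b , fails) = K + suc b , decide
      where
      decide : ∀ z → z < suc n → Verified z (K + suc b) → Correct z
      decide z z< v with m≤n⇒m<n∨m≡n (≤-pred z<)
      ... | inj₁ z<n    = h z z<n (λ b′ b′<K → v b′ (≤-trans b′<K (m≤m+n K (suc b))))
      ... | inj₂ ≡.refl = ⊥-elim (fails (v b (m≤n+m (suc b) K)))
    ... | K , h | no all = K , decide
      where
      correct : Correct n
      correct b with em {∃[ c ] T (instance-code n b c) ≡ 0}
      ... | yes c = c
      ... | no ¬c = ⊥-elim (all (b , ¬c))
      decide : ∀ z → z < suc n → Verified z K → Correct z
      decide z z< v with m≤n⇒m<n∨m≡n (≤-pred z<)
      ... | inj₁ z<n    = h z z<n v
      ... | inj₂ ≡.refl = correct

    -- At the threshold all verified candidates are correct, so a single chain there composes into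
    -- an instance of `E`.
    Conn⇒E : ∀ n {x y} → (∀ k → Conn n k x y) → E x y
    Conn⇒E n h = go (h (proj₁ (threshold n)))
      where
      sound : ∀ z → z < n → Verified z (proj₁ (threshold n)) → E (left z) (right z)
      sound z z<n v = correct⇒E z (proj₂ (threshold n) z z<n v)
      go : ∀ {x y} → Conn n (proj₁ (threshold n)) x y → E x y
      go here                 = E.refl
      go (forward z c z<n v)  = E.trans (go c) (sound z z<n v)
      go (backward z c z<n v) = E.trans (go c) (E.sym (sound z z<n v))

    -- The key `(N , x , y)` renames `x` to `y` below level `N`, from which on `x` and `y` are
    -- connected for all `k`; its bar has the same level bound and serves the inverse.
    E⇒≅ : ∀ {d i x y} → Presents d x → Presents i y → E x y → d ≅UF²₁ i
    E⇒≅ {x = x} {y} px py e = presentations-≅ px py κ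
      (subst₂ (λ i j → ∀ p v → Label i p v → Label j (act κ p) v) source≡ target≡
        (act-label κ (λ n k N≤n → subst₂ (Conn n k) (≡.sym target≡) (≡.sym source≡) (Conn-sym (conn n k (subst (_≤ n) (fst-pair N (pair x y)) N≤n))))))
      (subst₂ (λ i j → ∀ p v → Label i p v → Label j (act (bar κ) p) v)
        (≡.trans (source-bar κ) target≡) (≡.trans (target-bar κ) source≡)
        (act-label (bar κ) (λ n k N≤n → subst₂ (Conn n k)
          (≡.sym (≡.trans (target-bar κ) source≡)) (≡.sym (≡.trans (source-bar κ) target≡))
          (conn n k (subst (_≤ n) (≡.trans (level-bar κ) (fst-pair N (pair x y))) N≤n)))))
      where
      N = proj₁ (E⇒Conn e)
      conn : ∀ n k → N ≤ n → Conn n k x y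
      conn = proj₂ (E⇒Conn e)
      κ = pair N (pair x y)
      source≡ : source κ ≡ x
      source≡ = ≡.trans (cong fst (snd-pair N (pair x y))) (fst-pair x y)
      target≡ : target κ ≡ y
      target≡ = ≡.trans (cong snd (snd-pair N (pair x y))) (snd-pair x y)

    -- At position `(N , 0)` the queries for the name `x` succeed for `x` at every `k` by
    -- reflexivity. Being preserved at level `N`, they connect `y` to `x` there for all `k`.
    ≅⇒E : ∀ {d i x y} → Presents d x → Presents i y → d ≅UF²₁ i → E x y
    ≅⇒E {x = x} {y} px py iso = E.sym (Conn⇒E N (λ k → at k y (h (pair N 0) (pair x k) (≤-reflexive (≡.sym (fst-pair N 0))) (at⁻ k x here))))
      where
      preserves = hom-preserves-labels px py (to-sends iso)
      N = proj₁ preserves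
      h = proj₂ preserves
      label≡ : ∀ k y → Label y (pair N 0) (pair x k) ≡ Conn N k y x
      label≡ k y = ≡.trans
        (cong₂ (λ n c → Conn n (snd (pair x k)) (name y c) (fst (pair x k))) (fst-pair N 0) (snd-pair N 0))
        (cong₂ (λ k j → Conn N k y j) (snd-pair x k) (fst-pair x k))
      at : ∀ k y → Label y (pair N 0) (pair x k) → Conn N k y x
      at k y = subst (λ A → A) (label≡ k y)
      at⁻ : ∀ k y → Conn N k y x → Label y (pair N 0) (pair x k)
      at⁻ k y = subst (λ A → A) (≡.sym (label≡ k y))

    reduction : E ≤c _≅UF²₁_
    reduction = go presentations
      where
      go : (Σ (ℕ → ℕ) λ h → Computable h × (∀ x → Presents (h x) x)) → E ≤c _≅UF²₁_
      go (h , h-computable , presents) = h , h-computable , λ x y →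
        mk⇔ (E⇒≅ (presents x) (presents y)) (≅⇒E (presents x) (presents y))

-- From computable matrices to zero tests, and completeness.

≅-hard : ExcludedMiddle 0ℓ → (E : Rel ℕ 0ℓ) → IsEquivalence E → Σ⁰₃ E → E ≤c _≅UF²₁_
≅-hard em E E-equiv (R , R-computable , E⇔) with characteristic R-computable
... | T , T-realised , R⇔T = Approximation.reduction T T-realised em E-equiv λ x y → mk⇔
  (λ e → let (a , h) = Equivalence.to (E⇔ x y) e in
         a , λ b → proj₁ (h b) , Equivalence.to (R⇔T _) (proj₂ (h b)))
  (λ { (a , h) → Equivalence.from (E⇔ x y) (a , λ b → proj₁ (h b) , Equivalence.from (R⇔T _) (proj₂ (h b))) })

theorem5p3 : ExcludedMiddle 0ℓ →
    Σ⁰₃ _≅UF²₁_ ×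
    ((E : Rel ℕ 0ℓ) → IsEquivalence E → Σ⁰₃ E → E ≤c _≅UF²₁_)
theorem5p3 em = ≅-Σ⁰₃ , ≅-hard em
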